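{- Let $n=p_1^{n_1}p_2^{n_2}\cdots p_r^{n_r}$, where $p_1<p_2<\cdots<p_r$ are primes and $n_1,\ldots,n_r$ are positive integers. Assume $r\geq 4$, $n_r\geq 2$ and $2\phi(p_1p_2\cdots p_{r-1})<p_1p_2\cdots p_{r-1}$, and let $X$ be a minimum cut-set of the power graph $\mathcal{P}(C_n)$. Define $$\Omega:=\left\{j\in [r-1]\;\middle|\; n_j\geq 3,\; p_r-p_j\leq r-4,\; 2\phi\left(\frac{p_1p_2\cdots p_r}{p_j}\right)<\frac{p_1p_2\cdots p_r}{p_j}\right\}.$$ Then: (i) If $n_r\geq 3$ or $\Omega=\emptyset$, then $X=Z_r^{n_r}$ and hence $\kappa(\mathcal{P}(C_n))=\beta_r^{n_r}$. (ii) If $n_r=2$ and $\Omega\neq\emptyset$, then $X=Z_r^{n_r}$ or $X=Z_b^{n_b}$, where $b$ is the largest element of $\Omega$; consequently $\kappa(\mathcal{P}(C_n))\in\{\beta_b^{n_b},\beta_r^{n_r}\}$.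
   Context: $[m]=\{1,\dots,m\}$, $\phi$ is Euler's totient function, $C_n$ is the cyclic group of order $n$. The power graph $\mathcal{P}(C_n)$ has vertex set $C_n$, two distinct vertices adjacent iff one is a power of the other. A cut-set of a graph is a vertex subset whose removal leaves a disconnected induced subgraph; a minimum cut-set is one of least size; $\kappa$ denotes vertex connectivity (equal to the size of a minimum cut-set for non-complete graphs). For a divisor $d$ of $n$, $E_d$ is the set of elements of $C_n$ of order $d$ and $S_d$ the set of elements of order dividing $d$ (the subgroup of order $d$). For $a\in[r]$ and $s\in[n_a]$, let $Q_a^s=\bigcup_{i\in[r]\setminus\{a\}} S_{n/(p_ip_a^s)}$ and $Z_a^s:=E_n\cup E_{n/p_a}\cup E_{n/p_a^2}\cup\cdots\cup E_{n/p_a^{s-1}}\cup Q_a^s$, and $$\beta_a^s:=\phi(n)+\frac{n}{p_1\cdots p_r}\cdot\frac{1}{p_a^{s-1}}\left[\frac{p_1\cdots p_r}{p_a}+\phi\left(\frac{p_1\cdots p_r}{p_a}\right)(p_a^{s-1}-2)\right].$$ -}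

module Defs where

open import Data.Nat using (ℕ; zero; suc; _+_; _*_; _∸_; _^_; _≤_; _<_)
open import Data.Nat.DivMod using (_/_)
open import Data.Nat.Divisibility using (_∣_)
open import Data.Nat.GCD using (gcd)
open import Data.Nat.Properties using (_≟_)
open import Data.List using (List; length; filter; map; upTo)
open import Data.Fin using (Fin; toℕ)
open import Data.Fin.Subset using (Subset; _∈_; _∉_)
open import Data.Product using (Σ; ∃; _×_; _,_)
open import Data.Sum using (_⊎_)
open import Relation.Nullary using (¬_)
open import Relation.Binary.PropositionalEquality using (_≡_; _≢_)

-- Division, total by convention (m ÷ 0 = 0); every use below has a
-- nonzero divisor that divides the dividend, so this is exact division.
_÷_ : ℕ → ℕ → ℕ
m ÷ zero = 0
m ÷ suc d = m / suc d

-- prod f k = f 1 * f 2 * ... * f k  (1-based indices, as in the paper)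
prod : (ℕ → ℕ) → ℕ → ℕ
prod f zero = 1
prod f (suc k) = prod f k * f (suc k)

φ : ℕ → ℕ
φ m = length (filter (λ k → gcd k m ≟ 1) (map suc (upTo m)))

data Reach {N : ℕ} (Adj : Fin N → Fin N → Set) (X : Subset N) (u : Fin N) : Fin N → Set where
  here : u ∉ X → Reach Adj X u u
  step : ∀ {v w} → Reach Adj X u v → Adj v w → w ∉ X → Reach Adj X u w

IsCutSet : {N : ℕ} → (Fin N → Fin N → Set) → Subset N → Set
IsCutSet Adj X = ∃ λ u → ∃ λ v → u ∉ X × v ∉ X × ¬ Reach Adj X u v

IsMinCutSet : {N : ℕ} → (Fin N → Fin N → Set) → Subset N → Set
IsMinCutSet {N} Adj X = IsCutSet Adj X × ((Y : Subset N) → IsCutSet Adj Y → Data.Fin.Subset.∣ X ∣ ≤ Data.Fin.Subset.∣ Y ∣)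

-- The cyclic group C_N, realised additively as Z/NZ with elements
-- 0,…,N-1 (Fin N).  "y is a power of x" means y = x^k for some k,
-- i.e. k·x ≡ y (mod N), i.e. k·x = y + q·N (as y < N).

IsPowerOf : {N : ℕ} → Fin N → Fin N → Set
IsPowerOf {N} y x = ∃ λ k → ∃ λ q → k * toℕ x ≡ toℕ y + q * N

PowerAdj : (N : ℕ) → Fin N → Fin N → Set
PowerAdj N x y = x ≢ y × (IsPowerOf y x ⊎ IsPowerOf x y)

HasOrder : {N : ℕ} → Fin N → ℕ → Set
HasOrder {N} x d = 1 ≤ d × N ∣ d * toℕ x × (∀ k → 1 ≤ k → N ∣ k * toℕ x → d ≤ k)

InE : {N : ℕ} → ℕ → Fin N → Set
InE d x = HasOrder x d

InS : {N : ℕ} → ℕ → Fin N → Set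
InS d x = ∃ λ o → HasOrder x o × o ∣ d

-- The sets Z_a^s and numbers β_a^s, for n = ∏_{i=1}^r p_i^{e_i}
-- (p, e : ℕ → ℕ, used on indices 1..r).

InQ : (n r : ℕ) (p : ℕ → ℕ) (a s : ℕ) → Fin n → Set
InQ n r p a s x = ∃ λ i → 1 ≤ i × i ≤ r × i ≢ a × InS (n ÷ (p i * p a ^ s)) x

InZ : (n r : ℕ) (p : ℕ → ℕ) (a s : ℕ) → Fin n → Set
InZ n r p a s x = (∃ λ t → t < s × InE (n ÷ (p a ^ t)) x) ⊎ InQ n r p a s x

-- β_a^s = φ(n) + n/(p_1⋯p_r) · (1/p_a^{s-1}) · [P/p_a + φ(P/p_a)(p_a^{s-1} - 2)],
-- P = p_1⋯p_r.  (Only used with s ≥ 2, so p_a^{s-1} - 2 ≥ 0 and the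
-- division by p_1⋯p_r·p_a^{s-1} is exact.)
β : (n r : ℕ) (p : ℕ → ℕ) (a s : ℕ) → ℕ
β n r p a s =
  φ n + (n ÷ (prod p r * p a ^ (s ∸ 1)))
        * ((prod p r ÷ p a) + φ (prod p r ÷ p a) * (p a ^ (s ∸ 1) ∸ 2))

_≐_ : {N : ℕ} → Subset N → (Fin N → Set) → Set
_≐_ {N} X Z = (x : Fin N) → (x ∈ X → Z x) × (Z x → x ∈ X)

InΩ : (r : ℕ) (p e : ℕ → ℕ) → ℕ → Set
InΩ r p e j = 1 ≤ j × j ≤ r ∸ 1 × 3 ≤ e j × p r ∸ p j ≤ r ∸ 4
              × 2 * φ (prod p r ÷ p j) < prod p r ÷ p j

-- Write N = n, P = p₁⋯p_r, M_a = P/p_a, F_a = φ(M_a). In ℤ/N the element y is a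
-- power of x iff gcd(x,N) ∣ y, so Z_a^s consists of the x such that exactly
-- one of the following holds: p_a^s ∣ x; no p_i with i ≠ a divides x. If
-- N = h M_a p_a^s, counting gives |Z_a^s| + 2 h F_a = h M_a + h F_a p_a^s; all
-- these sets (1 ≤ s ≤ n_a) are cut-sets, so |X| is at most each of these numbers.
--
-- Let X be a minimum cut-set, with the vertices outside X split into two sides. X
-- contains the generators. Call the class gcd(x,N) = p_i a coatom. If no coatom
-- lies in X, then both sides contain coatoms and X contains every x divisible
-- by primes from both; there are at least as many such x as multiples of p_r
-- having another prime divisor, which gives |X| ≥ |Z_r^1| > |Z_r^2|. If two coatoms lie in X, or
-- only one does but the others are not all on the same side, X is again larger
-- than Z_r^2. Otherwise only the coatom of some a lies in X, the other coatoms are on one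
-- side, the other side consists of x with gcd(x,N) a power p_a^t, and X = Z_a^t
-- for the least such t.
--
-- Finally the sizes are compared. |Z_a^t| decreases in t if 2 F_a < M_a and is at
-- least N/2 otherwise. For a < b and |Z_a^t| ≤ |Z_b^(s+1)| one gets
-- p_b^s (p_b - p_a) + 3 p_a < r p_a + 2: with s = 2 this is absurd for b = r and for
-- b ∈ Ω, and with s = 1, b = r it says p_r - p_a ≤ r - 4.

module Submission where

open import Defs
open import Data.Bool using (true; false)
open import Data.Empty using (⊥; ⊥-elim)
open import Data.Fin using (Fin; toℕ; fromℕ<)
import Data.Fin as Fin
open import Data.Fin.Properties using (toℕ<n; toℕ-fromℕ<)
import Data.Fin.Properties as Finₚ
open import Data.Fin.Subset using (Subset; _∈_; _∉_)
open import Data.Fin.Subset.Properties using (_∈?_)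
open import Data.List using (length; filter; map; applyUpTo)
open import Data.Nat
open import Data.Nat.Coprimality as Coprimality using (Coprime; coprime-divisor)
open import Data.Nat.Divisibility
open import Data.Nat.DivMod using (m*n/n≡m)
open import Data.Nat.GCD
open import Data.Nat.Primality as Primality using (Prime; euclidsLemma; prime⇒nonZero; prime⇒nonTrivial; prime⇒irreducible; ¬prime[1])
open import Data.Nat.Properties
open import Data.Nat.Tactic.RingSolver using (solve-∀)
open import Data.Product using (∃; _×_; _,_; proj₁; proj₂)
open import Data.Sum using (_⊎_; inj₁; inj₂)
open import Data.Unit using (tt) renaming (⊤ to Unit)
open import Data.Vec as Vec using ([]; _∷_; tabulate)
open import Data.Vec.Properties using (lookup∘tabulate; []=⇒lookup; lookup⇒[]=)
open import Function using (_∘_; case_of_; id)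
open import Relation.Binary.Definitions using (tri<; tri≈; tri>)
open import Relation.Binary.PropositionalEquality hiding ([_])
open import Relation.Nullary using (¬_; Dec; yes; no; does; contradiction)
open import Relation.Nullary.Decidable using (_×-dec_; _⊎-dec_; _→-dec_; ¬?; decidable-stable; dec-true; ¬¬-excluded-middle)

-- Counting

Dec₁ : (ℕ → Set) → Set
Dec₁ P = ∀ x → Dec (P x)

ι : {A : Set} → Dec A → ℕ
ι (yes _) = 1
ι (no _)  = 0

ι-mono : {A B : Set} (a : Dec A) (b : Dec B) → (A → B) → ι a ≤ ι b
ι-mono (yes a) (yes _) f = ≤-refl
ι-mono (yes a) (no ¬b) f = contradiction (f a) ¬b
ι-mono (no _)  b       f = z≤n

ι-disjoint : {A B C : Set} (a : Dec A) (b : Dec B) (c : Dec C) →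
  (A → C) → (B → C) → (A → ¬ B) → ι a + ι b ≤ ι c
ι-disjoint (yes a) (yes b) c       f g h = contradiction b (h a)
ι-disjoint (yes a) (no _)  c       f g h = ι-mono (yes a) c f
ι-disjoint (no _)  b       c       f g h = ι-mono b c g

ι-cover : {A B C : Set} (a : Dec A) (b : Dec B) (c : Dec C) →
  (C → A ⊎ B) → ι c ≤ ι a + ι b
ι-cover a       b       (no _)  f = z≤n
ι-cover (yes _) b       (yes c) f = s≤s z≤n
ι-cover (no _)  (yes _) (yes c) f = ≤-refl
ι-cover (no ¬a) (no ¬b) (yes c) f with f c
... | inj₁ a = contradiction a ¬a
... | inj₂ b = contradiction b ¬b

-- Counting runs over initial segments of ℕ instead of `Fin n`, so that the length can be rewritten
-- as a product and cut into periods.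
count : {P : ℕ → Set} → Dec₁ P → ℕ → ℕ
count P? zero    = 0
count P? (suc n) = ι (P? 0) + count (P? ∘ suc) n

count-mono : {P Q : ℕ → Set} (P? : Dec₁ P) (Q? : Dec₁ Q) (n : ℕ) →
  (∀ x → x < n → P x → Q x) → count P? n ≤ count Q? n
count-mono P? Q? zero    f = z≤n
count-mono P? Q? (suc n) f =
  +-mono-≤ (ι-mono (P? 0) (Q? 0) (f 0 z<s))
           (count-mono (P? ∘ suc) (Q? ∘ suc) n λ x x<n → f (suc x) (s<s x<n))

count-cong : {P Q : ℕ → Set} (P? : Dec₁ P) (Q? : Dec₁ Q) (n : ℕ) →
  (∀ x → x < n → P x → Q x) → (∀ x → x < n → Q x → P x) → count P? n ≡ count Q? n
count-cong P? Q? n f g = ≤-antisym (count-mono P? Q? n f) (count-mono Q? P? n g)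

count-disjoint : {P Q R : ℕ → Set} (P? : Dec₁ P) (Q? : Dec₁ Q) (R? : Dec₁ R) (n : ℕ) →
  (∀ x → x < n → P x → R x) → (∀ x → x < n → Q x → R x) → (∀ x → x < n → P x → ¬ Q x) →
  count P? n + count Q? n ≤ count R? n
count-disjoint P? Q? R? zero    f g h = z≤n
count-disjoint P? Q? R? (suc n) f g h = begin
  (ι (P? 0) + p) + (ι (Q? 0) + q) ≡⟨ shuffle (ι (P? 0)) p (ι (Q? 0)) q ⟩
  (ι (P? 0) + ι (Q? 0)) + (p + q) ≤⟨ +-mono-≤
    (ι-disjoint (P? 0) (Q? 0) (R? 0) (f 0 z<s) (g 0 z<s) (h 0 z<s))
    (count-disjoint (P? ∘ suc) (Q? ∘ suc) (R? ∘ suc) n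
      (λ x l → f (suc x) (s<s l)) (λ x l → g (suc x) (s<s l)) (λ x l → h (suc x) (s<s l))) ⟩
  ι (R? 0) + count (R? ∘ suc) n   ∎
  where
  open ≤-Reasoning
  p = count (P? ∘ suc) n
  q = count (Q? ∘ suc) n
  shuffle : ∀ a b c d → (a + b) + (c + d) ≡ (a + c) + (b + d)
  shuffle = solve-∀

count-cover : {P Q R : ℕ → Set} (P? : Dec₁ P) (Q? : Dec₁ Q) (R? : Dec₁ R) (n : ℕ) →
  (∀ x → x < n → R x → P x ⊎ Q x) → count R? n ≤ count P? n + count Q? n
count-cover P? Q? R? zero    f = z≤n
count-cover P? Q? R? (suc n) f = begin
  ι (R? 0) + count (R? ∘ suc) n   ≤⟨ +-mono-≤
    (ι-cover (P? 0) (Q? 0) (R? 0) (f 0 z<s))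
    (count-cover (P? ∘ suc) (Q? ∘ suc) (R? ∘ suc) n λ x l → f (suc x) (s<s l)) ⟩
  (ι (P? 0) + ι (Q? 0)) + (p + q) ≡⟨ shuffle (ι (P? 0)) (ι (Q? 0)) p q ⟩
  (ι (P? 0) + p) + (ι (Q? 0) + q) ∎
  where
  open ≤-Reasoning
  p = count (P? ∘ suc) n
  q = count (Q? ∘ suc) n
  shuffle : ∀ a b c d → (a + b) + (c + d) ≡ (a + c) + (b + d)
  shuffle = solve-∀

count-partition : {P Q R : ℕ → Set} (P? : Dec₁ P) (Q? : Dec₁ Q) (R? : Dec₁ R) (n : ℕ) →
  (∀ x → x < n → P x → R x) → (∀ x → x < n → Q x → R x) → (∀ x → x < n → P x → ¬ Q x) →
  (∀ x → x < n → R x → P x ⊎ Q x) → count P? n + count Q? n ≡ count R? n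
count-partition P? Q? R? n f g h k =
  ≤-antisym (count-disjoint P? Q? R? n f g h) (count-cover P? Q? R? n k)

count-full : {P : ℕ → Set} (P? : Dec₁ P) (n : ℕ) → (∀ x → x < n → P x) → count P? n ≡ n
count-full P? zero    f = refl
count-full P? (suc n) f with P? 0
... | yes _ = cong suc (count-full (P? ∘ suc) n λ x l → f (suc x) (s<s l))
... | no ¬p = contradiction (f 0 z<s) ¬p

count-empty : {P : ℕ → Set} (P? : Dec₁ P) (n : ℕ) → (∀ x → x < n → ¬ P x) → count P? n ≡ 0
count-empty P? zero    f = refl
count-empty P? (suc n) f with P? 0
... | yes p = contradiction p (f 0 z<s)
... | no _  = count-empty (P? ∘ suc) n λ x l → f (suc x) (s<s l)

count-complement : {P : ℕ → Set} (P? : Dec₁ P) (n : ℕ) →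
  count P? n + count (λ x → ¬? (P? x)) n ≡ n
count-complement {P} P? n = trans
  (count-partition P? (λ x → ¬? (P? x)) (λ _ → yes tt) n (λ _ _ _ → tt) (λ _ _ _ → tt)
    (λ _ _ p ¬p → ¬p p) (λ x _ _ → either x))
  (count-full (λ _ → yes tt) n (λ _ _ → tt))
  where
  either : ∀ x → P x ⊎ ¬ P x
  either x with P? x
  ... | yes p = inj₁ p
  ... | no ¬p = inj₂ ¬p

count-+ : {P : ℕ → Set} (P? : Dec₁ P) (m n : ℕ) →
  count P? (m + n) ≡ count P? m + count (λ x → P? (m + x)) n
count-+ P? zero    n = refl
count-+ P? (suc m) n = trans (cong (ι (P? 0) +_) (count-+ (P? ∘ suc) m n))
                             (sym (+-assoc (ι (P? 0)) _ _))

count-positive : {P : ℕ → Set} (P? : Dec₁ P) (n x : ℕ) → x < n → P x → 1 ≤ count P? n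
count-positive P? (suc n) zero    l p = ≤-trans (ι-mono (yes p) (P? 0) id) (m≤m+n _ _)
count-positive P? (suc n) (suc x) l p =
  ≤-trans (count-positive (P? ∘ suc) n x (s<s⁻¹ l) p) (m≤n+m _ (ι (P? 0)))

-- An `x` in `Q` but not in `P` would add at least one to the count of `Q`. This turns an inclusion
-- together with a cardinality bound into an equality of sets.
count-saturated : {P Q : ℕ → Set} (P? : Dec₁ P) (Q? : Dec₁ Q) (n : ℕ) →
  (∀ x → x < n → P x → Q x) → count Q? n ≤ count P? n → ∀ x → x < n → Q x → P x
count-saturated P? Q? n f le x x<n q with P? x
... | yes p = p
... | no ¬p = contradiction le (<⇒≱ (begin
    suc (count P? n)            ≤⟨ +-monoˡ-≤ _ (count-positive gap? n x x<n (q , ¬p)) ⟩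
    count gap? n + count P? n   ≤⟨ count-disjoint gap? P? Q? n (λ _ _ → proj₁) f (λ _ _ (_ , ¬p) → ¬p) ⟩
    count Q? n                  ∎))
  where
  open ≤-Reasoning
  gap? = λ y → Q? y ×-dec ¬? (P? y)

Periodic : ℕ → (ℕ → Set) → Set
Periodic L P = ∀ x → (P x → P (L + x)) × (P (L + x) → P x)

count-periodic : {P : ℕ → Set} (P? : Dec₁ P) (L : ℕ) → Periodic L P →
  ∀ k → count P? (k * L) ≡ k * count P? L
count-periodic P? L per zero    = refl
count-periodic P? L per (suc k) = trans (count-+ P? L (k * L)) (cong (count P? L +_) (trans
  (count-cong (λ x → P? (L + x)) P? (k * L) (λ x _ → proj₂ (per x)) (λ x _ → proj₁ (per x)))
  (count-periodic P? L per k)))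

-- Adding the equal indicators of `0` and `n` completes both counts to the count up to `suc n`. This
-- relates counting over `1..n` to counting over `0..n-1`.
count-shift : {P : ℕ → Set} (P? : Dec₁ P) (n : ℕ) → (P 0 → P n) → (P n → P 0) →
  count (P? ∘ suc) n ≡ count P? n
count-shift P? n f g = +-cancelˡ-≡ (ι (P? 0)) _ _ (begin
  count P? (suc n)                        ≡⟨ cong (count P?) (+-comm 1 n) ⟩
  count P? (n + 1)                        ≡⟨ count-+ P? n 1 ⟩
  count P? n + (ι (P? (n + 0)) + 0)       ≡⟨ cong (count P? n +_) (+-identityʳ _) ⟩
  count P? n + ι (P? (n + 0))             ≡⟨ cong (λ k → count P? n + ι (P? k)) (+-identityʳ n) ⟩
  count P? n + ι (P? n)                   ≡⟨ cong (count P? n +_) (≤-antisym (ι-mono (P? n) (P? 0) g) (ι-mono (P? 0) (P? n) f)) ⟩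
  count P? n + ι (P? 0)                   ≡⟨ +-comm (count P? n) _ ⟩
  ι (P? 0) + count P? n                   ∎)
  where open ≡-Reasoning

-- A block of `p` consecutive numbers starting at a multiple of `p` contains one multiple, its first
-- element. The induction strips one block and shifts `P` by `p`.
count-multiples : {P : ℕ → Set} (P? : Dec₁ P) (p : ℕ) .{{_ : NonZero p}} (L : ℕ) →
  count (λ x → p ∣? x ×-dec P? x) (p * L) ≡ count (λ y → P? (p * y)) L
count-multiples P? p zero = cong (count (λ x → p ∣? x ×-dec P? x)) (*-zeroʳ p)
count-multiples {P} P? p@(suc p-1) (suc L) = begin
  count D? (p * suc L)                              ≡⟨ cong (count D?) (*-suc p L) ⟩
  count D? (p + p * L)                              ≡⟨ count-+ D? p (p * L) ⟩
  count D? p + count (λ x → D? (p + x)) (p * L)     ≡⟨ cong₂ _+_ first rest ⟩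
  ι (P? (p * 0)) + count (λ y → P? (p * suc y)) L   ∎
  where
  open ≡-Reasoning
  D? = λ x → p ∣? x ×-dec P? x
  first : count D? p ≡ ι (P? (p * 0))
  first = begin
    ι (D? 0) + count (D? ∘ suc) p-1 ≡⟨ cong (ι (D? 0) +_)
      (count-empty (D? ∘ suc) p-1 λ x x<p (d , _) → >⇒∤ (s<s x<p) d) ⟩
    ι (D? 0) + 0                    ≡⟨ +-identityʳ _ ⟩
    ι (D? 0)                        ≡⟨ ≤-antisym
      (ι-mono (D? 0) (P? (p * 0)) λ (_ , q) → subst P (sym (*-zeroʳ p)) q)
      (ι-mono (P? (p * 0)) (D? 0) λ q → p ∣0 , subst P (*-zeroʳ p) q) ⟩
    ι (P? (p * 0))                  ∎
  rest : count (λ x → D? (p + x)) (p * L) ≡ count (λ y → P? (p * suc y)) L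
  rest = begin
    count (λ x → D? (p + x)) (p * L) ≡⟨ count-cong (λ x → D? (p + x)) (λ x → p ∣? x ×-dec P? (p + x)) (p * L)
      (λ x _ (d , q) → ∣m+n∣m⇒∣n d ∣-refl , q) (λ x _ (d , q) → ∣m∣n⇒∣m+n ∣-refl d , q) ⟩
    count (λ x → p ∣? x ×-dec P? (p + x)) (p * L) ≡⟨ count-multiples (λ x → P? (p + x)) p L ⟩
    count (λ y → P? (p + p * y)) L   ≡⟨ count-cong (λ y → P? (p + p * y)) (λ y → P? (p * suc y)) L
      (λ y _ → subst P (sym (*-suc p y))) (λ y _ → subst P (*-suc p y)) ⟩
    count (λ y → P? (p * suc y)) L   ∎

Invariant : ℕ → (ℕ → Set) → Set
Invariant p P = ∀ x → (P x → P (p * x)) × (P (p * x) → P x)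

-- For a property unaffected by multiplication by p, divisibility by p is
-- independent of it: this replaces every appeal to the Chinese remainder theorem.
count-∣ : {P : ℕ → Set} (P? : Dec₁ P) (p : ℕ) .{{_ : NonZero p}} (L : ℕ) → Invariant p P →
  count (λ x → p ∣? x ×-dec P? x) (p * L) ≡ count P? L
count-∣ P? p L inv = trans (count-multiples P? p L)
  (count-cong (λ y → P? (p * y)) P? L (λ x _ → proj₂ (inv x)) (λ x _ → proj₁ (inv x)))

-- The total over `suc p` periods is `suc p` copies of one period, and the multiples of `suc p`
-- account for one copy. The modulus is a successor so that the factor `p` appears without
-- subtraction.
count-∤ : {P : ℕ → Set} (P? : Dec₁ P) (p : ℕ) (L : ℕ) → Invariant (suc p) P → Periodic L P →
  count (λ x → ¬? (suc p ∣? x) ×-dec P? x) (suc p * L) ≡ p * count P? L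
count-∤ {P} P? p L inv per = +-cancelˡ-≡ (count P? L) _ _ (begin
  count P? L + count N? (suc p * L)             ≡⟨ cong (_+ count N? (suc p * L)) (count-∣ P? (suc p) L inv) ⟨
  count D? (suc p * L) + count N? (suc p * L)   ≡⟨ count-partition D? N? P? (suc p * L)
    (λ _ _ → proj₂) (λ _ _ → proj₂) (λ _ _ (d , _) (¬d , _) → ¬d d) (λ x _ → either x) ⟩
  count P? (suc p * L)                          ≡⟨ count-periodic P? L per (suc p) ⟩
  count P? L + p * count P? L                   ∎)
  where
  open ≡-Reasoning
  D? = λ x → suc p ∣? x ×-dec P? x
  N? = λ x → ¬? (suc p ∣? x) ×-dec P? x
  either : ∀ x → P x → (suc p ∣ x × P x) ⊎ ((¬ suc p ∣ x) × P x)
  either x q with suc p ∣? x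
  ... | yes d = inj₁ (d , q)
  ... | no ¬d = inj₂ (¬d , q)

-- Products over primes and Euler's function

-- Strict inequalities are used in this form so that later estimates become polynomial identities
-- over ℕ with a visibly positive term.
<⇒excess : ∀ {m k} → m < k → ∃ λ d → k ≡ m + suc d
<⇒excess {m} m<k with m≤n⇒∃[o]m+o≡n m<k
... | d , eq = d , trans (sym eq) (sym (+-suc m d))

-- The default value 1 lets a product over any decidable set of indices run over the full range
-- `1..k`.
pick : {A : Set} → Dec A → ℕ → ℕ
pick (yes _) m = m
pick (no _)  m = 1

pick-yes : {A : Set} (a : Dec A) {m : ℕ} → A → pick a m ≡ m
pick-yes (yes _) a = refl
pick-yes (no ¬a) a = contradiction a ¬a

pick-no : {A : Set} (a : Dec A) {m : ℕ} → ¬ A → pick a m ≡ 1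
pick-no (yes a) ¬a = contradiction a ¬a
pick-no (no _)  ¬a = refl

pick-⇔ : {A B : Set} (a : Dec A) (b : Dec B) {m : ℕ} → (A → B) → (B → A) → pick a m ≡ pick b m
pick-⇔ (yes a) b f g = sym (pick-yes b (f a))
pick-⇔ (no ¬a) b f g = sym (pick-no b (¬a ∘ g))

sel : {K : ℕ → Set} → Dec₁ K → (ℕ → ℕ) → ℕ → ℕ
sel K? f i = pick (K? i) (f i)

except? : ∀ a → Dec₁ (λ i → i ≢ a)
except? a i = ¬? (i ≟ a)

except₂? : ∀ a b → Dec₁ (λ i → i ≢ a × i ≢ b)
except₂? a b i = except? a i ×-dec except? b i

InRange : ℕ → (ℕ → Set) → Set
InRange k P = ∀ i → 1 ≤ i → i ≤ k → P i

InRange-≤ : ∀ {k l P} → k ≤ l → InRange l P → InRange k P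
InRange-≤ k≤l h i 1≤i i≤k = h i 1≤i (≤-trans i≤k k≤l)

prod-cong : ∀ {f g} k → InRange k (λ i → f i ≡ g i) → prod f k ≡ prod g k
prod-cong zero    h = refl
prod-cong (suc k) h = cong₂ _*_ (prod-cong k (InRange-≤ (n≤1+n k) h)) (h (suc k) z<s ≤-refl)

prod-positive : ∀ {f} k → InRange k (λ i → 1 ≤ f i) → 1 ≤ prod f k
prod-positive zero    h = ≤-refl
prod-positive (suc k) h = *-mono-≤ (prod-positive k (InRange-≤ (n≤1+n k) h)) (h (suc k) z<s ≤-refl)

prod-mono : ∀ {f g} k → InRange k (λ i → f i ≤ g i) → prod f k ≤ prod g k
prod-mono zero    h = ≤-refl
prod-mono (suc k) h = *-mono-≤ (prod-mono k (InRange-≤ (n≤1+n k) h)) (h (suc k) z<s ≤-refl)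

prod-∣ : ∀ {f} {m} k → InRange k (λ i → m i ∣ f i) → prod m k ∣ prod f k
prod-∣ zero    h = ∣-refl
prod-∣ (suc k) h = *-pres-∣ (prod-∣ k (InRange-≤ (n≤1+n k) h)) (h (suc k) z<s ≤-refl)

factor-∣-prod : ∀ f k i → 1 ≤ i → i ≤ k → f i ∣ prod f k
factor-∣-prod f zero    i 1≤i i≤k = contradiction (≤-trans 1≤i i≤k) λ ()
factor-∣-prod f (suc k) i 1≤i i≤k with i ≟ suc k
... | yes refl = n∣m*n (prod f k)
... | no i≢    = ∣m⇒∣m*n (f (suc k)) (factor-∣-prod f k i 1≤i (s≤s⁻¹ (≤∧≢⇒< i≤k i≢)))

sel-positive : ∀ {K} (K? : Dec₁ K) {f} k → InRange k (λ i → 1 ≤ f i) → InRange k (λ i → 1 ≤ sel K? f i)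
sel-positive K? k h i 1≤i i≤k with K? i
... | yes _ = h i 1≤i i≤k
... | no _  = ≤-refl

sel-∣ : ∀ {K} (K? : Dec₁ K) {f g} k → InRange k (λ i → f i ∣ g i) → InRange k (λ i → sel K? f i ∣ sel K? g i)
sel-∣ K? k h i 1≤i i≤k with K? i
... | yes _ = h i 1≤i i≤k
... | no _  = ∣-refl

factor-∣-sel : ∀ {K} (K? : Dec₁ K) f k i → 1 ≤ i → i ≤ k → K i → f i ∣ prod (sel K? f) k
factor-∣-sel K? f k i 1≤i i≤k Ki =
  subst (_∣ prod (sel K? f) k) (pick-yes (K? i) Ki) (factor-∣-prod (sel K? f) k i 1≤i i≤k)

-- The hypotheses say that `K′` is `K` without `a`. In this form the lemma removes an index from the
-- full range as well as from a range that already lacks one.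
prod-extract : ∀ {K K′} (K? : Dec₁ K) (K′? : Dec₁ K′) f a k → 1 ≤ a → a ≤ k → K a → ¬ K′ a →
  (∀ i → i ≢ a → K i → K′ i) → (∀ i → K′ i → K i) →
  prod (sel K? f) k ≡ f a * prod (sel K′? f) k
prod-extract K? K′? f a zero    1≤a a≤k Ka ¬K′a to from = contradiction (≤-trans 1≤a a≤k) λ ()
prod-extract K? K′? f a (suc k) 1≤a a≤k Ka ¬K′a to from with a ≟ suc k
... | yes refl = begin
  prod (sel K? f) k * sel K? f a          ≡⟨ cong₂ _*_
    (prod-cong k λ i _ i≤k → pick-⇔ (K? i) (K′? i) (to i (<⇒≢ (s≤s i≤k))) (from i))
    (pick-yes (K? a) Ka) ⟩
  prod (sel K′? f) k * f a                ≡⟨ *-comm _ (f a) ⟩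
  f a * prod (sel K′? f) k                ≡⟨ cong (f a *_) (*-identityʳ _) ⟨
  f a * (prod (sel K′? f) k * 1)          ≡⟨ cong (λ m → f a * (prod (sel K′? f) k * m)) (pick-no (K′? a) ¬K′a) ⟨
  f a * (prod (sel K′? f) k * sel K′? f a) ∎
  where open ≡-Reasoning
... | no a≢ = trans
  (cong₂ _*_ (prod-extract K? K′? f a k 1≤a (s≤s⁻¹ (≤∧≢⇒< a≤k a≢)) Ka ¬K′a to from)
             (pick-⇔ (K? (suc k)) (K′? (suc k)) (to (suc k) (≢-sym a≢)) (from (suc k))))
  (*-assoc (f a) _ _)

prod-except : ∀ f a k → 1 ≤ a → a ≤ k → prod f k ≡ f a * prod (sel (except? a) f) k
prod-except f a k 1≤a a≤k = prod-extract (λ _ → yes tt) (except? a) f a k 1≤a a≤k tt (λ a≢a → a≢a refl)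
  (λ _ i≢a _ → i≢a) (λ _ _ → tt)

prod-except₂ : ∀ f a b k → b ≢ a → 1 ≤ b → b ≤ k →
  prod (sel (except? a) f) k ≡ f b * prod (sel (except₂? a b) f) k
prod-except₂ f a b k b≢a 1≤b b≤k = prod-extract (except? a) (except₂? a b) f b k 1≤b b≤k b≢a
  (λ h → proj₂ h refl) (λ _ i≢b i≢a → i≢a , i≢b) (λ _ → proj₁)

prod-except-last : ∀ f k → 1 ≤ k → prod (sel (except? k) f) k ≡ prod f (k ∸ 1)
prod-except-last f (suc k) _ = trans (cong₂ _*_
  (prod-cong k λ i _ i≤k → pick-yes (except? (suc k) i) (<⇒≢ (s≤s i≤k)))
  (pick-no (except? (suc k) (suc k)) λ k≢k → k≢k refl)) (*-identityʳ (prod f k))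

selected : {K : ℕ → Set} → Dec₁ K → ℕ → ℕ
selected K? zero    = 0
selected K? (suc k) = ι (K? (suc k)) + selected K? k

ι≤1 : {A : Set} (a : Dec A) → ι a ≤ 1
ι≤1 a = ι-mono a (yes tt) (λ _ → tt)

ι-no : {A : Set} (a : Dec A) → ¬ A → ι a ≡ 0
ι-no (yes a) ¬a = contradiction a ¬a
ι-no (no _)  ¬a = refl

selected-≤ : ∀ {K} (K? : Dec₁ K) k → selected K? k ≤ k
selected-≤ K? zero    = z≤n
selected-≤ K? (suc k) = +-mono-≤ (ι≤1 (K? (suc k))) (selected-≤ K? k)

selected-< : ∀ {K} (K? : Dec₁ K) a k → 1 ≤ a → a ≤ k → ¬ K a → selected K? k < k
selected-< K? a zero    1≤a a≤k ¬Ka = ≤-trans 1≤a a≤k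
selected-< K? a (suc k) 1≤a a≤k ¬Ka with a ≟ suc k
... | yes refl rewrite ι-no (K? a) ¬Ka = s≤s (selected-≤ K? k)
... | no a≢    = +-mono-≤-< (ι≤1 (K? (suc k))) (selected-< K? a k 1≤a (s≤s⁻¹ (≤∧≢⇒< a≤k a≢)) ¬Ka)

selected-<₂ : ∀ {K} (K? : Dec₁ K) a b k → 1 ≤ a → a < b → b ≤ k → ¬ K a → ¬ K b → 2 + selected K? k ≤ k
selected-<₂ K? a b zero    1≤a a<b b≤k ¬Ka ¬Kb = contradiction (≤-trans a<b b≤k) λ ()
selected-<₂ K? a b (suc k) 1≤a a<b b≤k ¬Ka ¬Kb with b ≟ suc k
... | yes refl rewrite ι-no (K? b) ¬Kb = s≤s (selected-< K? a k 1≤a (s≤s⁻¹ a<b) ¬Ka)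
... | no b≢    = begin
  2 + (ι (K? (suc k)) + selected K? k) ≤⟨ +-monoʳ-≤ 2 (+-monoˡ-≤ _ (ι≤1 (K? (suc k)))) ⟩
  suc (2 + selected K? k)              ≤⟨ s≤s (selected-<₂ K? a b k 1≤a a<b (s≤s⁻¹ (≤∧≢⇒< b≤k b≢)) ¬Ka ¬Kb) ⟩
  suc k                                ∎
  where open ≤-Reasoning

-- ∏ p/(p-1) over c distinct primes is at most ∏_{j≤c} (j+1)/j = c + 1.
prod-≤-selected : ∀ {K} (K? : Dec₁ K) p k → InRange k (λ i → i < p i) →
  prod (sel K? p) k ≤ suc (selected K? k) * prod (sel K? (pred ∘ p)) k
prod-≤-selected K? p zero    h = ≤-refl
prod-≤-selected K? p (suc k) h with K? (suc k) | prod-≤-selected K? p k (InRange-≤ (n≤1+n k) h)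
... | no _  | ih = ≤-trans (*-monoˡ-≤ 1 ih) (≤-reflexive (*-assoc (suc (selected K? k)) (prod (sel K? (pred ∘ p)) k) 1))
... | yes _ | ih = begin
  R * p (suc k)               ≤⟨ *-monoˡ-≤ (p (suc k)) ih ⟩
  suc c * T * p (suc k)       ≡⟨ cong (suc c * T *_) q≡ ⟨
  suc c * T * suc q           ≡⟨ expand c T q ⟩
  T * (suc c * q + suc c)     ≤⟨ *-monoʳ-≤ T (+-monoʳ-≤ (suc c * q) c<q) ⟩
  T * (suc c * q + q)         ≡⟨ collect c T q ⟩
  suc (suc c) * (T * q)       ∎
  where
  open ≤-Reasoning
  R = prod (sel K? p) k
  T = prod (sel K? (pred ∘ p)) k
  c = selected K? k
  q = pred (p (suc k))
  k<p : suc k < p (suc k)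
  k<p = h (suc k) z<s ≤-refl
  q≡ : suc q ≡ p (suc k)
  q≡ = suc-pred (p (suc k)) {{>-nonZero (≤-trans (s≤s z≤n) k<p)}}
  c<q : c < q
  c<q = s≤s⁻¹ (subst (2 + c ≤_) (sym q≡) (≤-trans (s≤s (s≤s (selected-≤ K? k))) k<p))
  expand : ∀ c T q → suc c * T * suc q ≡ T * (suc c * q + suc c)
  expand = solve-∀
  collect : ∀ c T q → T * (suc c * q + q) ≡ suc (suc c) * (T * q)
  collect = solve-∀

prime-∤⇒coprime : ∀ {p x} → Prime p → ¬ p ∣ x → Coprime x p
prime-∤⇒coprime pp p∤x (d∣x , d∣p) with prime⇒irreducible pp d∣p
... | inj₁ d≡1  = d≡1
... | inj₂ refl = contradiction d∣x p∤x

coprime-* : ∀ {x a b} → Coprime x a → Coprime x b → Coprime x (a * b)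
coprime-* x⊥a x⊥b (d∣x , d∣ab) =
  x⊥b (d∣x , coprime-divisor (λ (e∣d , e∣a) → x⊥a (∣-trans e∣d d∣x , e∣a)) d∣ab)

coprime-1 : ∀ {x} → Coprime x 1
coprime-1 (_ , d∣1) = ∣1⇒≡1 d∣1

coprime-^ : ∀ {x a} → Coprime x a → ∀ k → Coprime x (a ^ k)
coprime-^ x⊥a zero    = coprime-1
coprime-^ x⊥a (suc k) = coprime-* x⊥a (coprime-^ x⊥a k)

prime-∣-prime : ∀ {p q} → Prime p → Prime q → p ∣ q → p ≡ q
prime-∣-prime pp pq p∣q with prime⇒irreducible pq p∣q
... | inj₁ refl = contradiction pp ¬prime[1]
... | inj₂ p≡q  = p≡q

2∣n⊎2∣1+n : ∀ m → (2 ∣ m) ⊎ (2 ∣ suc m)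
2∣n⊎2∣1+n zero    = inj₁ (2 ∣0)
2∣n⊎2∣1+n (suc m) with 2∣n⊎2∣1+n m
... | inj₁ d = inj₂ (∣m∣n⇒∣m+n ∣-refl d)
... | inj₂ d = inj₁ d

-- If `Q` were `P + 1`, one of the two would be even and hence equal to 2, too small for `4 ≤ Q`.
prime-gap : ∀ {P Q} → Prime P → Prime Q → 4 ≤ Q → P < Q → 2 + P ≤ Q
prime-gap {P} {Q} primeP primeQ 4≤Q P<Q with Q ≟ suc P
... | no Q≢    = ≤∧≢⇒< P<Q (≢-sym Q≢)
... | yes refl with 2∣n⊎2∣1+n P
...   | inj₁ d = contradiction (prime-∣-prime Primality.prime[2] primeP d) λ { refl → contradiction 4≤Q λ { (s≤s (s≤s (s≤s ()))) } }
...   | inj₂ d = contradiction (prime-∣-prime Primality.prime[2] primeQ d) λ { refl → contradiction 4≤Q λ { (s≤s (s≤s ())) } }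

prime-power-divisor : ∀ {p} → Prime p → ∀ e d → d ∣ p ^ e → ∃ λ t → t ≤ e × d ≡ p ^ t
prime-power-divisor pp zero    d d∣ = 0 , z≤n , ∣1⇒≡1 d∣
prime-power-divisor {p} pp (suc e) d d∣ with p ∣? d
... | no p∤d = 0 , z≤n , coprime-^ (prime-∤⇒coprime pp p∤d) (suc e) (∣-refl , d∣)
... | yes (divides d′ refl)
  with t , t≤e , refl ← prime-power-divisor pp e d′
         (*-cancelˡ-∣ p {{prime⇒nonZero pp}} (subst (_∣ p ^ suc e) (*-comm d′ p) d∣))
  = suc t , s≤s t≤e , *-comm (p ^ t) p

-- The bound is written `i < suc k` because `anyUpTo?` decides existence in that form.
Hit : ℕ → (ℕ → Set) → (ℕ → ℕ) → ℕ → Set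
Hit k K p x = ∃ λ i → i < suc k × (1 ≤ i × K i × p i ∣ x)

hit? : ∀ k {K} → Dec₁ K → ∀ p → Dec₁ (Hit k K p)
hit? k K? p x = anyUpTo? (λ i → 1 ≤? i ×-dec K? i ×-dec p i ∣? x) (suc k)

Periodic-¬ : ∀ {L P} → Periodic L P → Periodic L (λ x → ¬ P x)
Periodic-¬ h x = (_∘ proj₂ (h x)) , (_∘ proj₁ (h x))

Invariant-¬ : ∀ {q P} → Invariant q P → Invariant q (λ x → ¬ P x)
Invariant-¬ h x = (_∘ proj₂ (h x)) , (_∘ proj₁ (h x))

hit-periodic : ∀ {k K p L} → (∀ i → 1 ≤ i → i ≤ k → K i → p i ∣ L) → Periodic L (Hit k K p)
hit-periodic h x =
  (λ (i , i≤k , 1≤i , Ki , d) → i , i≤k , 1≤i , Ki , ∣m∣n⇒∣m+n (h i 1≤i (s≤s⁻¹ i≤k) Ki) d) ,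
  (λ (i , i≤k , 1≤i , Ki , d) → i , i≤k , 1≤i , Ki , ∣m+n∣m⇒∣n d (h i 1≤i (s≤s⁻¹ i≤k) Ki))

-- By Euclid's lemma a prime `p i` different from `q` divides `q * x` only if it divides `x`.
hit-invariant : ∀ {k K p q} → Prime q → InRange k (λ i → Prime (p i)) →
  (∀ i → 1 ≤ i → i ≤ k → K i → p i ≢ q) → Invariant q (Hit k K p)
hit-invariant {q = q} pq pp h x =
  (λ (i , i≤k , 1≤i , Ki , d) → i , i≤k , 1≤i , Ki , ∣n⇒∣m*n q d) ,
  λ (i , i≤k , 1≤i , Ki , d) → i , i≤k , 1≤i , Ki ,
    (case euclidsLemma q x (pp i 1≤i (s≤s⁻¹ i≤k)) d of λ where
      (inj₁ d′) → contradiction (prime-∣-prime (pp i 1≤i (s≤s⁻¹ i≤k)) pq d′) (h i 1≤i (s≤s⁻¹ i≤k) Ki)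
      (inj₂ d′) → d′)

Distinct : ℕ → (ℕ → ℕ) → Set
Distinct k p = ∀ i j → 1 ≤ i → i ≤ k → 1 ≤ j → j ≤ k → p i ≡ p j → i ≡ j

miss? : ∀ k {K} → Dec₁ K → ∀ p → Dec₁ (λ x → ¬ Hit k K p x)
miss? k K? p x = ¬? (hit? k K? p x)

-- This is the product formula for Euler's function. The condition on the earlier primes is periodic
-- and invariant under multiplication by the new one, so `count-∤` contributes the factor
-- `pred (p (suc k))`.
count-miss : ∀ {K} (K? : Dec₁ K) p k → InRange k (λ i → Prime (p i)) → Distinct k p →
  count (miss? k K? p) (prod (sel K? p) k) ≡ prod (sel K? (pred ∘ p)) k
-- The empty product is 1, so only `x = 0` is counted, and no index lies between 1 and 0.
count-miss K? p zero pp dist with hit? 0 K? p 0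
... | yes (zero , _ , () , _)
... | yes (suc i , s≤s () , _)
... | no _ = refl
count-miss {K} K? p (suc k) pp dist = factor (K? (suc k))
  where
  open ≡-Reasoning
  R = prod (sel K? p) k
  T = prod (sel K? (pred ∘ p)) k
  ih : count (miss? k K? p) R ≡ T
  ih = count-miss K? p k (InRange-≤ (n≤1+n k) pp)
    λ i j a b c d → dist i j a (m≤n⇒m≤1+n b) c (m≤n⇒m≤1+n d)
  q = pred (p (suc k))
  q≡ : suc q ≡ p (suc k)
  q≡ = suc-pred (p (suc k)) {{prime⇒nonZero (pp (suc k) z<s ≤-refl)}}
  weaken : ∀ x → ¬ Hit (suc k) K p x → ¬ Hit k K p x
  weaken x miss (i , i≤k , hit) = miss (i , m<n⇒m<1+n i≤k , hit)
  extend : ∀ x → ¬ (K (suc k) × suc q ∣ x) → ¬ Hit k K p x → ¬ Hit (suc k) K p x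
  extend x ¬d miss (i , i≤k , 1≤i , Ki , d) with i ≟ suc k
  ... | yes refl = ¬d (Ki , subst (_∣ x) (sym q≡) d)
  ... | no i≢    = miss (i , ≤∧≢⇒< (s≤s⁻¹ i≤k) i≢ , 1≤i , Ki , d)
  factor : (Kk : Dec (K (suc k))) →
    count (miss? (suc k) K? p) (R * pick Kk (p (suc k))) ≡ T * pick Kk q
  factor (no ¬K) = begin
    count (miss? (suc k) K? p) (R * 1) ≡⟨ cong (count (miss? (suc k) K? p)) (*-identityʳ R) ⟩
    count (miss? (suc k) K? p) R       ≡⟨ count-cong (miss? (suc k) K? p) (miss? k K? p) R
      (λ x _ → weaken x) (λ x _ → extend x (¬K ∘ proj₁)) ⟩
    count (miss? k K? p) R             ≡⟨ ih ⟩
    T                                  ≡⟨ *-identityʳ T ⟨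
    T * 1                              ∎
  factor (yes Kk) = begin
    count (miss? (suc k) K? p) (R * p (suc k))  ≡⟨ cong (count (miss? (suc k) K? p)) (*-comm R _) ⟩
    count (miss? (suc k) K? p) (p (suc k) * R)  ≡⟨ cong (λ m → count (miss? (suc k) K? p) (m * R)) q≡ ⟨
    count (miss? (suc k) K? p) (suc q * R)      ≡⟨ count-cong (miss? (suc k) K? p)
      (λ x → ¬? (suc q ∣? x) ×-dec miss? k K? p x) (suc q * R)
      (λ x _ miss → (λ d → miss (suc k , ≤-refl , z<s , Kk , subst (_∣ x) q≡ d)) , weaken x miss)
      (λ x _ (¬d , miss) → extend x (¬d ∘ proj₂) miss) ⟩
    count (λ x → ¬? (suc q ∣? x) ×-dec miss? k K? p x) (suc q * R) ≡⟨ count-∤ (miss? k K? p) q R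
      (Invariant-¬ {suc q} (hit-invariant {q = suc q} (subst Prime (sym q≡) (pp (suc k) z<s ≤-refl)) (InRange-≤ (n≤1+n k) pp)
        (λ i 1≤i i≤k _ e → <⇒≢ (s≤s i≤k)
          (dist i (suc k) 1≤i (m≤n⇒m≤1+n i≤k) z<s ≤-refl (trans e q≡)))))
      (Periodic-¬ (hit-periodic λ i 1≤i i≤k Ki → factor-∣-sel K? p k i 1≤i i≤k Ki)) ⟩
    q * count (miss? k K? p) R                  ≡⟨ cong (q *_) ih ⟩
    q * T                                       ≡⟨ *-comm q T ⟩
    T * q                                       ∎

-- Arbitrary exponents let the statement serve `n`, its cofactors `rest a` and, with all exponents
-- 1, squarefree products.
miss⇒coprime : ∀ {K} (K? : Dec₁ K) (p e : ℕ → ℕ) k x → InRange k (λ i → Prime (p i)) →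
  ¬ Hit k K p x → Coprime x (prod (sel K? (λ i → p i ^ e i)) k)
miss⇒coprime K? p e zero    x pp miss = coprime-1
miss⇒coprime K? p e (suc k) x pp miss = coprime-*
  (miss⇒coprime K? p e k x (InRange-≤ (n≤1+n k) pp)
    λ (i , i≤k , hit) → miss (i , m<n⇒m<1+n i≤k , hit))
  last
  where
  last : Coprime x (sel K? (λ i → p i ^ e i) (suc k))
  last with K? (suc k)
  ... | yes Kk = coprime-^ (prime-∤⇒coprime (pp (suc k) z<s ≤-refl)
                   λ d → miss (suc k , ≤-refl , z<s , Kk , d)) (e (suc k))
  ... | no _   = coprime-1

coprime⇒miss : ∀ {K p k x m} → InRange k (λ i → Prime (p i)) →
  (∀ i → 1 ≤ i → i ≤ k → K i → p i ∣ m) → Coprime x m → ¬ Hit k K p x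
coprime⇒miss pp h x⊥m (i , i≤k , 1≤i , Ki , d) =
  ¬prime[1] (subst Prime (x⊥m (d , h i 1≤i (s≤s⁻¹ i≤k) Ki)) (pp i 1≤i (s≤s⁻¹ i≤k)))

length-filter-applyUpTo : {P : ℕ → Set} (P? : Dec₁ P) (g f : ℕ → ℕ) (m : ℕ) →
  length (filter P? (map g (applyUpTo f m))) ≡ count (λ k → P? (g (f k))) m
length-filter-applyUpTo P? g f zero    = refl
length-filter-applyUpTo P? g f (suc m) with P? (g (f 0))
... | yes _ = cong suc (length-filter-applyUpTo P? g (f ∘ suc) m)
... | no _  = length-filter-applyUpTo P? g (f ∘ suc) m

φ-count : ∀ m → φ m ≡ count (λ x → gcd x m ≟ 1) m
φ-count m = trans (length-filter-applyUpTo (λ k → gcd k m ≟ 1) suc id m)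
  -- `φ` lists `1..m` while `count` runs over `0..m-1`; the ends `m` and `0` have the same gcd with
  -- `m`.
  (count-shift (λ x → gcd x m ≟ 1) m (trans gcd-0) (trans (sym gcd-0)))
  where
  gcd-0 : gcd m m ≡ gcd 0 m
  gcd-0 = ∣-antisym (subst (gcd m m ∣_) (sym (gcd-identityˡ m)) (gcd[m,n]∣m m m))
                    (gcd-greatest {m} {m} (gcd[m,n]∣n 0 m) (gcd[m,n]∣n 0 m))

-- Being coprime to a product of distinct primes means missing all of them, which `count-miss`
-- counts.
φ-prod : ∀ {K} (K? : Dec₁ K) p k → InRange k (λ i → Prime (p i)) → Distinct k p →
  φ (prod (sel K? p) k) ≡ prod (sel K? (pred ∘ p)) k
φ-prod K? p k pp dist = begin
  φ M                         ≡⟨ φ-count M ⟩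
  count (λ x → gcd x M ≟ 1) M ≡⟨ count-cong (λ x → gcd x M ≟ 1) (miss? k K? p) M
    (λ x _ g → coprime⇒miss pp (factor-∣-sel K? p k) (Coprimality.gcd≡1⇒coprime g))
    (λ x _ miss → Coprimality.coprime⇒gcd≡1 (subst (Coprime x)
      (prod-cong k λ i _ _ → cong (pick (K? i)) (*-identityʳ (p i)))
      (miss⇒coprime K? p (λ _ → 1) k x pp miss))) ⟩
  count (miss? k K? p) M      ≡⟨ count-miss K? p k pp dist ⟩
  prod (sel K? (pred ∘ p)) k  ∎
  where
  open ≡-Reasoning
  M = prod (sel K? p) k

-- Powers and orders in ℤ/N

-- `IsPowerOf` asks for natural coefficients, so a Bézout identity with a negative coefficient of
-- `x` has to be corrected by multiples of `N`.
bézout-multiple : ∀ x y N → y < N → gcd x N ∣ y → ∃ λ k → ∃ λ q → k * x ≡ y + q * N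
bézout-multiple zero y N@(suc _) y<N g∣y with y
... | zero  = 0 , 0 , refl
... | suc z = contradiction (subst (_∣ suc z) (gcd-identityˡ N) g∣y) (>⇒∤ y<N)
bézout-multiple x@(suc x′) y N@(suc N′) y<N (divides c refl)
  with Bézout.identity (gcd-GCD x N)
... | Bézout.+- a b eq = c * a , c * b , (begin
  c * a * x                 ≡⟨ *-assoc c a x ⟩
  c * (a * x)               ≡⟨ cong (c *_) eq ⟨
  c * (gcd x N + b * N)     ≡⟨ distribute c (gcd x N) b N ⟩
  c * gcd x N + c * b * N   ∎)
  where
  open ≡-Reasoning
  distribute : ∀ c d b N → c * (d + b * N) ≡ c * d + c * b * N
  distribute = solve-∀
-- The coefficient `- a` is replaced by `a * (N - 1)`, and the summand `b * N` keeps `q` a natural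
-- number.
... | Bézout.-+ a b eq = k , q , +-cancelʳ-≡ (c * (a * x)) _ _ (begin
  k * x + c * (a * x)                                   ≡⟨ expand a b c x′ N′ ⟩
  c * (b * N) + c * (a * x * N + b * x′ * N)            ≡⟨ cong (λ m → c * m + c * (a * x * N + b * x′ * N)) eq ⟨
  c * (gcd x N + a * x) + c * (a * x * N + b * x′ * N)  ≡⟨ collect (gcd x N) a b c x′ N ⟩
  c * gcd x N + q * N + c * (a * x)                     ∎)
  where
  open ≡-Reasoning
  k = c * (a * N′ + b * N)
  q = c * (a * x + b * x′)
  expand : ∀ a b c x′ N′ → c * (a * N′ + b * suc N′) * suc x′ + c * (a * suc x′) ≡
    c * (b * suc N′) + c * (a * suc x′ * suc N′ + b * x′ * suc N′)
  expand = solve-∀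
  collect : ∀ d a b c x′ N → c * (d + a * suc x′) + c * (a * suc x′ * N + b * x′ * N) ≡
    c * d + c * (a * suc x′ + b * x′) * N + c * (a * suc x′)
  collect = solve-∀

module _ {N : ℕ} where

  gcd∣⇒power : (x y : Fin N) → gcd (toℕ x) N ∣ toℕ y → IsPowerOf y x
  gcd∣⇒power x y = bézout-multiple (toℕ x) (toℕ y) N (toℕ<n y)

  power⇒∣ : (x y : Fin N) → IsPowerOf y x → ∀ {m} → m ∣ N → m ∣ toℕ x → m ∣ toℕ y
  power⇒∣ x y (k , q , eq) {m} m∣N m∣x = ∣m+n∣m⇒∣n
    (subst (m ∣_) (trans eq (+-comm (toℕ y) (q * N))) (∣n⇒∣m*n k m∣x)) (∣n⇒∣m*n q m∣N)

  -- The order is the cofactor of `gcd x N` in `N`. Once the gcd is cancelled, `d` and `x₀` are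
  -- coprime, so `N ∣ k * x` forces `d ∣ k`.
  order-exists : (x : Fin N) → ∃ λ d → HasOrder x d × d * gcd (toℕ x) N ≡ N
  order-exists x = d , (1≤d , N∣dx , minimal) , sym d≡
    where
    instance
      nz : NonZero N
      nz = >-nonZero (≤-trans (s≤s z≤n) (toℕ<n x))
    g = gcd (toℕ x) N
    d = quotient (gcd[m,n]∣n (toℕ x) N)
    d≡ : N ≡ d * g
    d≡ = m∣n⇒n≡quotient*m (gcd[m,n]∣n (toℕ x) N)
    x₀ = quotient (gcd[m,n]∣m (toℕ x) N)
    x≡ : toℕ x ≡ x₀ * g
    x≡ = m∣n⇒n≡quotient*m (gcd[m,n]∣m (toℕ x) N)
    instance
      g≢0 : NonZero g
      g≢0 = ≢-nonZero (gcd[m,n]≢0 (toℕ x) N (inj₂ (≢-nonZero⁻¹ N)))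
      d≢0 : NonZero d
      d≢0 = quotient≢0 (gcd[m,n]∣n (toℕ x) N)
    1≤d : 1 ≤ d
    1≤d = >-nonZero⁻¹ d
    d⊥x₀ : Coprime d x₀
    d⊥x₀ {c} (c∣d , c∣x₀) = ∣1⇒≡1 (*-cancelʳ-∣ g (subst (c * g ∣_) (sym (*-identityˡ g))
      (gcd-greatest (subst (c * g ∣_) (sym x≡) (*-monoˡ-∣ g c∣x₀))
                    (subst (c * g ∣_) (sym d≡) (*-monoˡ-∣ g c∣d)))))
    N∣dx : N ∣ d * toℕ x
    N∣dx = subst₂ _∣_ (sym d≡) (cong (d *_) (sym x≡)) (*-monoʳ-∣ d (n∣m*n x₀))
    minimal : ∀ k → 1 ≤ k → N ∣ k * toℕ x → d ≤ k
    minimal k 1≤k N∣kx = ∣⇒≤ {{>-nonZero 1≤k}} (coprime-divisor d⊥x₀ (subst (d ∣_) (*-comm k x₀)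
      (*-cancelʳ-∣ g (subst₂ _∣_ d≡ (trans (cong (k *_) x≡) (sym (*-assoc k x₀ g))) N∣kx))))

  order-unique : {x : Fin N} {c d : ℕ} → HasOrder x c → HasOrder x d → c ≡ d
  order-unique (1≤c , N∣cx , minc) (1≤d , N∣dx , mind) =
    ≤-antisym (minc _ 1≤d N∣dx) (mind _ 1≤c N∣cx)

  order⇒gcd : (x : Fin N) {d : ℕ} → HasOrder x d → d * gcd (toℕ x) N ≡ N
  order⇒gcd x ord with d₀ , ord₀ , eq ← order-exists x rewrite order-unique ord ord₀ = eq

  gcd⇒order : (x : Fin N) {d : ℕ} → d * gcd (toℕ x) N ≡ N → HasOrder x d
  gcd⇒order x {d} eq with d₀ , ord₀ , eq₀ ← order-exists x =
    subst (HasOrder x) (*-cancelʳ-≡ d₀ d (gcd (toℕ x) N) {{g≢0}} (trans eq₀ (sym eq))) ord₀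
    where
    g≢0 : NonZero (gcd (toℕ x) N)
    g≢0 = ≢-nonZero (gcd[m,n]≢0 (toℕ x) N (inj₂ (>⇒≢ (≤-trans (s≤s z≤n) (toℕ<n x)))))

÷-exact : ∀ k d .{{_ : NonZero d}} → (k * d) ÷ d ≡ k
÷-exact k (suc d) = m*n/n≡m k (suc d)

÷-* : ∀ {N} m .{{_ : NonZero m}} → m ∣ N → (N ÷ m) * m ≡ N
÷-* m (divides c refl) = cong (_* m) (÷-exact c m)

-- Order and gcd multiply to `N`. This translates the classes `E` into gcd classes here, and the
-- subgroups `S` into sets of multiples below.
InE⇒gcd : ∀ {N m} .{{_ : NonZero m}} → m ∣ N → (x : Fin N) → InE (N ÷ m) x → gcd (toℕ x) N ≡ m
InE⇒gcd {N} {m} m∣N x ord@(1≤d , _) = *-cancelˡ-≡ (gcd (toℕ x) N) m (N ÷ m) {{>-nonZero 1≤d}}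
  (trans (order⇒gcd x ord) (sym (÷-* m m∣N)))

gcd⇒InE : ∀ {N m} .{{_ : NonZero m}} → m ∣ N → (x : Fin N) → gcd (toℕ x) N ≡ m → InE (N ÷ m) x
gcd⇒InE {N} {m} m∣N x eq = gcd⇒order x (trans (cong ((N ÷ m) *_) eq) (÷-* m m∣N))

InS⇒∣ : ∀ {N m} .{{_ : NonZero m}} → m ∣ N → (x : Fin N) → InS (N ÷ m) x → m ∣ toℕ x
InS⇒∣ {N} {m} m∣N x (o , ord@(1≤o , _) , divides b eq) =
  ∣-trans (divides b (*-cancelˡ-≡ (gcd (toℕ x) N) (b * m) o {{>-nonZero 1≤o}} (begin
    o * gcd (toℕ x) N ≡⟨ order⇒gcd x ord ⟩
    N                 ≡⟨ ÷-* m m∣N ⟨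
    (N ÷ m) * m       ≡⟨ cong (_* m) eq ⟩
    b * o * m         ≡⟨ shuffle b o m ⟩
    o * (b * m)       ∎))) (gcd[m,n]∣m (toℕ x) N)
  where
  open ≡-Reasoning
  shuffle : ∀ b o m → b * o * m ≡ o * (b * m)
  shuffle = solve-∀

∣⇒InS : ∀ {N m} .{{_ : NonZero m}} → m ∣ N → (x : Fin N) → m ∣ toℕ x → InS (N ÷ m) x
∣⇒InS {N} {m} m∣N x m∣x
  with d , ord , eq ← order-exists x
     | divides b g≡ ← gcd-greatest {toℕ x} {N} m∣x m∣N
  = d , ord , divides b (*-cancelʳ-≡ (N ÷ m) (b * d) m (begin
    (N ÷ m) * m       ≡⟨ ÷-* m m∣N ⟩
    N                 ≡⟨ eq ⟨
    d * gcd (toℕ x) N ≡⟨ cong (d *_) g≡ ⟩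
    d * (b * m)       ≡⟨ shuffle d b m ⟩
    b * d * m         ∎))
  where
  open ≡-Reasoning
  shuffle : ∀ d b m → d * (b * m) ≡ b * d * m
  shuffle = solve-∀

^-∣ : ∀ p {s t} → s ≤ t → p ^ s ∣ p ^ t
^-∣ p {s} {t} s≤t = subst (p ^ s ∣_) (trans (sym (^-distribˡ-+-* p s (t ∸ s))) (cong (p ^_) (m+[n∸m]≡n s≤t)))
  (m∣m*n (p ^ (t ∸ s)))

Invariant-^ : ∀ {q P} → Invariant q P → ∀ s → Invariant (q ^ s) P
Invariant-^ {q} {P} inv zero    x rewrite +-identityʳ x = id , id
Invariant-^ {q} {P} inv (suc s) x rewrite *-assoc q (q ^ s) x =
  (λ h → proj₁ (inv _) (proj₁ (Invariant-^ inv s x) h)) ,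
  (λ h → proj₂ (Invariant-^ inv s x) (proj₂ (inv _) h))

-- Subsets of Fin N as decidable predicates on ℕ

open import Data.Fin.Subset using (∣_∣)

toWitness′ : {A : Set} (a : Dec A) → does a ≡ true → A
toWitness′ (yes a) _ = a

-- Recursion on the vector makes the count of `Member X` unfold in step with `∣ X ∣`.
Member : ∀ {N} → Subset N → ℕ → Set
Member []      x       = ⊥
Member (b ∷ X) zero    = b ≡ true
Member (b ∷ X) (suc x) = Member X x

member? : ∀ {N} (X : Subset N) → Dec₁ (Member X)
member? []          x       = no id
member? (true ∷ X)  zero    = yes refl
member? (false ∷ X) zero    = no λ ()
member? (b ∷ X)     (suc x) = member? X x

card≡count : ∀ {N} (X : Subset N) → ∣ X ∣ ≡ count (member? X) N
card≡count []          = refl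
card≡count (true ∷ X)  = cong suc (card≡count X)
card≡count (false ∷ X) = card≡count X

∈⇒Member : ∀ {N} {X : Subset N} {x} → x ∈ X → Member X (toℕ x)
∈⇒Member Vec.here      = refl
∈⇒Member (Vec.there h) = ∈⇒Member h

Member⇒∈ : ∀ {N} {X : Subset N} {x} → Member X (toℕ x) → x ∈ X
Member⇒∈ {X = b ∷ X} {Fin.zero}  refl = Vec.here
Member⇒∈ {X = b ∷ X} {Fin.suc x} h    = Vec.there (Member⇒∈ h)

least : ∀ {P : ℕ → Set} → Dec₁ P → ∀ n → P n → ∃ λ m → m ≤ n × P m × (∀ k → k < m → ¬ P k)
least {P} P? n Pn with search n
  where
  search : ∀ n → (∀ k → k < n → ¬ P k) ⊎ (∃ λ m → m < n × P m × (∀ k → k < m → ¬ P k))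
  search zero    = inj₁ λ _ ()
  search (suc n) with search n | P? n
  ... | inj₂ (m , m<n , rest) | _      = inj₂ (m , m<n⇒m<1+n m<n , rest)
  ... | inj₁ none             | yes Pn = inj₂ (n , ≤-refl , Pn , none)
  ... | inj₁ none             | no ¬Pn = inj₁ λ k k≤n Pk → case k ≟ n of λ where
    (yes refl) → ¬Pn Pk
    (no k≢n)   → none k (≤∧≢⇒< (s≤s⁻¹ k≤n) k≢n) Pk
... | inj₁ none                = n , ≤-refl , Pn , none
... | inj₂ (m , m<n , Pm , lo) = m , <⇒≤ m<n , Pm , lo

-- Finitely many instances of excluded middle hold together under a double negation. This makes
-- reachability decidable inside the proof of a decidable statement.
¬¬-decidable : ∀ {N} (P : Fin N → Set) → ¬ ¬ (∀ x → Dec (P x))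
¬¬-decidable {zero}  P k = k λ ()
¬¬-decidable {suc N} P k = ¬¬-decidable (P ∘ Fin.suc) λ rest → ¬¬-excluded-middle λ first →
  k λ { Fin.zero → first ; (Fin.suc x) → rest x }

-- The sets Z_a^s and their sizes

module Setting (r : ℕ) (p e : ℕ → ℕ) (n : ℕ)
  (prime : InRange r (λ i → Prime (p i)))
  (increasing : ∀ i j → 1 ≤ i → i < j → j ≤ r → p i < p j)
  (e≥1 : InRange r (λ i → 1 ≤ e i))
  (n≡ : n ≡ prod (λ i → p i ^ e i) r) where

  distinct : Distinct r p
  distinct i j 1≤i i≤r 1≤j j≤r eq with <-cmp i j
  ... | tri< i<j _ _ = contradiction eq (<⇒≢ (increasing i j 1≤i i<j j≤r))
  ... | tri≈ _ i≡j _ = i≡j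
  ... | tri> _ _ j<i = contradiction (sym eq) (<⇒≢ (increasing j i 1≤j j<i i≤r))

  p≥2 : InRange r (λ i → 2 ≤ p i)
  p≥2 i 1≤i i≤r = nonTrivial⇒n>1 (p i) {{prime⇒nonTrivial (prime i 1≤i i≤r)}}

  p≥1 : InRange r (λ i → 1 ≤ p i)
  p≥1 i 1≤i i≤r = <⇒≤ (p≥2 i 1≤i i≤r)

  p>index : InRange r (λ i → i < p i)
  p>index zero          ()  _
  p>index (suc zero)    1≤i i≤r = p≥2 1 1≤i i≤r
  p>index (suc i@(suc _)) 1≤i i≤r =
    ≤-trans (s≤s (p>index i z<s (<⇒≤ i≤r))) (increasing i (suc i) z<s ≤-refl i≤r)

  M F : ℕ → ℕ
  M a = prod (sel (except? a) p) r
  F a = prod (sel (except? a) (pred ∘ p)) r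

  F≥1 : ∀ a → 1 ≤ F a
  F≥1 a = prod-positive r (sel-positive (except? a) r λ i 1≤i i≤r → pred-mono-≤ (p≥2 i 1≤i i≤r))

  Other : ℕ → ℕ → Set
  Other a = Hit r (λ i → i ≢ a) p

  other? : ∀ a → Dec₁ (Other a)
  other? a = hit? r (except? a) p

  noOther? : ∀ a → Dec₁ (λ x → ¬ Other a x)
  noOther? a = miss? r (except? a) p

  -- For `s ≤ e a` the first alternative is the union of the classes `E` with exponents below `s`,
  -- and the second is `Q`. The arithmetical form makes the set decidable and countable.
  ZSet : ℕ → ℕ → ℕ → Set
  ZSet a s x = ((¬ Other a x) × (¬ p a ^ s ∣ x)) ⊎ (Other a x × p a ^ s ∣ x)

  low? : ∀ a s → Dec₁ (λ x → (¬ Other a x) × (¬ p a ^ s ∣ x))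
  low? a s x = noOther? a x ×-dec ¬? (p a ^ s ∣? x)

  high? : ∀ a s → Dec₁ (λ x → Other a x × p a ^ s ∣ x)
  high? a s x = other? a x ×-dec p a ^ s ∣? x

  zSet? : ∀ a s → Dec₁ (ZSet a s)
  zSet? a s x = low? a s x ⊎-dec high? a s x

  size : ℕ → ℕ → ℕ
  size a s = count (zSet? a s) n

  rest : ℕ → ℕ
  rest a = prod (sel (except? a) (λ i → p i ^ e i)) r

  n≡rest : ∀ a → 1 ≤ a → a ≤ r → n ≡ p a ^ e a * rest a
  n≡rest a 1≤a a≤r = trans n≡ (prod-except (λ i → p i ^ e i) a r 1≤a a≤r)

  prod≡ : ∀ a → 1 ≤ a → a ≤ r → prod p r ≡ p a * M a
  prod≡ a = prod-except p a r

  p∣p^e : InRange r (λ i → p i ∣ p i ^ e i)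
  p∣p^e i 1≤i i≤r = subst (_∣ p i ^ e i) (^-identityʳ (p i)) (^-∣ (p i) (e≥1 i 1≤i i≤r))

  M∣rest : ∀ a → M a ∣ rest a
  M∣rest a = prod-∣ r (sel-∣ (except? a) r p∣p^e)

  p∣rest : ∀ a i → 1 ≤ i → i ≤ r → i ≢ a → p i ∣ rest a
  p∣rest a i 1≤i i≤r i≢a = ∣-trans (p∣p^e i 1≤i i≤r)
    (factor-∣-sel (except? a) (λ i → p i ^ e i) r i 1≤i i≤r i≢a)

  n≥1 : 1 ≤ n
  n≥1 = subst (1 ≤_) (sym n≡) (prod-positive r λ i 1≤i i≤r →
    m^n>0 (p i) {{prime⇒nonZero (prime i 1≤i i≤r)}} (e i))

  p^∣n : ∀ a s → 1 ≤ a → a ≤ r → s ≤ e a → p a ^ s ∣ n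
  p^∣n a s 1≤a a≤r s≤e = subst (p a ^ s ∣_) (sym (n≡rest a 1≤a a≤r)) (∣m⇒∣m*n (rest a) (^-∣ (p a) s≤e))

  p∣n : InRange r (λ i → p i ∣ n)
  p∣n i 1≤i i≤r = subst (_∣ n) (^-identityʳ (p i)) (p^∣n i 1 1≤i i≤r (e≥1 i 1≤i i≤r))

  pp^∣n : ∀ i a s → 1 ≤ i → i ≤ r → 1 ≤ a → a ≤ r → i ≢ a → s ≤ e a → p i * p a ^ s ∣ n
  pp^∣n i a s 1≤i i≤r 1≤a a≤r i≢a s≤e =
    subst (p i * p a ^ s ∣_) (trans (*-comm (rest a) (p a ^ e a)) (sym (n≡rest a 1≤a a≤r)))
      (*-pres-∣ (p∣rest a i 1≤i i≤r i≢a) (^-∣ (p a) s≤e))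

  -- `gcd x n` is coprime to `rest a`, hence divides `p a ^ e a`.
  gcd-noOther : ∀ a x → 1 ≤ a → a ≤ r → ¬ Other a x → ∃ λ t → t ≤ e a × gcd x n ≡ p a ^ t
  gcd-noOther a x 1≤a a≤r miss = prime-power-divisor (prime a 1≤a a≤r) (e a) (gcd x n)
    (coprime-divisor g⊥rest (subst (gcd x n ∣_) (trans (n≡rest a 1≤a a≤r) (*-comm (p a ^ e a) (rest a)))
      (gcd[m,n]∣n x n)))
    where
    g⊥rest : Coprime (gcd x n) (rest a)
    g⊥rest (d∣g , d∣rest) = miss⇒coprime (except? a) p e r x prime miss
      (∣-trans d∣g (gcd[m,n]∣m x n) , d∣rest)

  p∤p^ : ∀ i a s → 1 ≤ i → i ≤ r → 1 ≤ a → a ≤ r → i ≢ a → ¬ p i ∣ p a ^ s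
  p∤p^ i a s 1≤i i≤r 1≤a a≤r i≢a d = ¬prime[1] (subst Prime
    (coprime-^ (prime-∤⇒coprime (prime a 1≤a a≤r) λ d′ → i≢a (distinct i a 1≤i i≤r 1≤a a≤r
      (sym (prime-∣-prime (prime a 1≤a a≤r) (prime i 1≤i i≤r) d′)))) s (∣-refl , d))
    (prime i 1≤i i≤r))

  p^-∣-injective : ∀ a {s t} → 1 ≤ a → a ≤ r → p a ^ s ∣ p a ^ t → s ≤ t
  p^-∣-injective a {s} {t} 1≤a a≤r d with s ≤? t
  ... | yes s≤t = s≤t
  ... | no s≰t  = contradiction (∣⇒≤ {{m^n≢0 (p a) t {{prime⇒nonZero (prime a 1≤a a≤r)}}}} d)
    (<⇒≱ (^-monoʳ-< (p a) (p≥2 a 1≤a a≤r) (≰⇒> s≰t)))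

  pp^-∣ : ∀ i a s x → 1 ≤ i → i ≤ r → 1 ≤ a → a ≤ r → i ≢ a → p i ∣ x → p a ^ s ∣ x → p i * p a ^ s ∣ x
  pp^-∣ i a s _ 1≤i i≤r 1≤a a≤r i≢a pi∣x (divides c refl)
    with euclidsLemma c (p a ^ s) (prime i 1≤i i≤r) pi∣x
  ... | inj₁ d = *-monoˡ-∣ (p a ^ s) d
  ... | inj₂ d = contradiction d (p∤p^ i a s 1≤i i≤r 1≤a a≤r i≢a)

  module _ (a s : ℕ) (1≤a : 1 ≤ a) (a≤r : a ≤ r) (s≤e : s ≤ e a) where

    private
      p^≢0 : ∀ t → NonZero (p a ^ t)
      p^≢0 t = m^n≢0 (p a) t {{prime⇒nonZero (prime a 1≤a a≤r)}}

      pp^≢0 : ∀ i → 1 ≤ i → i ≤ r → NonZero (p i * p a ^ s)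
      pp^≢0 i 1≤i i≤r = m*n≢0 (p i) (p a ^ s) {{prime⇒nonZero (prime i 1≤i i≤r)}} {{p^≢0 s}}

    InZ⇒ZSet : (x : Fin n) → InZ n r p a s x → ZSet a s (toℕ x)
    InZ⇒ZSet x (inj₁ (t , t<s , inE)) = inj₁ (miss , below)
      where
      g≡ : gcd (toℕ x) n ≡ p a ^ t
      g≡ = InE⇒gcd {{p^≢0 t}} (p^∣n a t 1≤a a≤r (≤-trans (<⇒≤ t<s) s≤e)) x inE
      miss : ¬ Other a (toℕ x)
      miss (i , i≤r , 1≤i , i≢a , d) = p∤p^ i a t 1≤i (s≤s⁻¹ i≤r) 1≤a a≤r i≢a
        (subst (p i ∣_) g≡ (gcd-greatest d (p∣n i 1≤i (s≤s⁻¹ i≤r))))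
      below : ¬ p a ^ s ∣ toℕ x
      below d = <⇒≱ t<s (p^-∣-injective a 1≤a a≤r
        (subst (p a ^ s ∣_) g≡ (gcd-greatest d (p^∣n a s 1≤a a≤r s≤e))))
    InZ⇒ZSet x (inj₂ (i , 1≤i , i≤r , i≢a , inS)) =
      inj₂ ((i , s≤s i≤r , 1≤i , i≢a , m*n∣⇒m∣ (p i) (p a ^ s) d) , m*n∣⇒n∣ (p i) (p a ^ s) d)
      where
      d : p i * p a ^ s ∣ toℕ x
      d = InS⇒∣ {{pp^≢0 i 1≤i i≤r}} (pp^∣n i a s 1≤i i≤r 1≤a a≤r i≢a s≤e) x inS

    ZSet⇒InZ : (x : Fin n) → ZSet a s (toℕ x) → InZ n r p a s x
    ZSet⇒InZ x (inj₁ (miss , below)) with gcd-noOther a (toℕ x) 1≤a a≤r miss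
    ... | t , t≤e , g≡ = inj₁ (t , t<s , gcd⇒InE {{p^≢0 t}} (p^∣n a t 1≤a a≤r t≤e) x g≡)
      where
      t<s : t < s
      t<s with t <? s
      ... | yes t<s = t<s
      ... | no t≮s  = contradiction
        (∣-trans (^-∣ (p a) (≮⇒≥ t≮s)) (subst (_∣ toℕ x) g≡ (gcd[m,n]∣m (toℕ x) n))) below
    ZSet⇒InZ x (inj₂ ((i , i<1+r , 1≤i , i≢a , d) , d′)) = inj₂ (i , 1≤i , i≤r , i≢a ,
      ∣⇒InS {{pp^≢0 i 1≤i i≤r}} (pp^∣n i a s 1≤i i≤r 1≤a a≤r i≢a s≤e) x
        (pp^-∣ i a s (toℕ x) 1≤i i≤r 1≤a a≤r i≢a d d′))
      where i≤r = s≤s⁻¹ i<1+r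

    -- All sizes are computed from this factorisation: below `h * M a` the condition `Other a` runs
    -- through `h` periods, and divisibility by `p a ^ s` is independent of it.
    scale : ∃ λ h → 1 ≤ h × n ≡ h * M a * p a ^ s
    scale with M∣rest a | ^-∣ (p a) s≤e
    ... | divides c c≡ | divides d d≡ = h , h≥1 , eq
      where
      h = d * c
      shuffle : ∀ d q c m → d * q * (c * m) ≡ d * c * m * q
      shuffle = solve-∀
      eq : n ≡ h * M a * p a ^ s
      eq = begin
        n                          ≡⟨ n≡rest a 1≤a a≤r ⟩
        p a ^ e a * rest a         ≡⟨ cong₂ _*_ d≡ c≡ ⟩
        d * p a ^ s * (c * M a)    ≡⟨ shuffle d (p a ^ s) c (M a) ⟩
        h * M a * p a ^ s          ∎
        where open ≡-Reasoning
      h≥1 : 1 ≤ h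
      h≥1 = n≢0⇒n>0 λ h≡0 → contradiction (trans eq (cong (λ m → m * M a * p a ^ s) h≡0)) (>⇒≢ n≥1)

  M-periodic : ∀ a c → Periodic (c * M a) (λ x → ¬ Other a x)
  M-periodic a c = Periodic-¬ (hit-periodic λ i 1≤i i≤r i≢a →
    ∣n⇒∣m*n c (factor-∣-sel (except? a) p r i 1≤i i≤r i≢a))

  count-noOther : ∀ a c → count (noOther? a) (c * M a) ≡ c * F a
  count-noOther a c = trans
    (count-periodic (noOther? a) (M a) (subst (λ L → Periodic L (λ x → ¬ Other a x)) (*-identityˡ (M a)) (M-periodic a 1)) c)
    (cong (c *_) (count-miss (except? a) p r prime distinct))

  other-invariant : ∀ a → 1 ≤ a → a ≤ r → Invariant (p a) (Other a)
  other-invariant a 1≤a a≤r = hit-invariant (prime a 1≤a a≤r) prime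
    λ i 1≤i i≤r i≢a → i≢a ∘ distinct i a 1≤i i≤r 1≤a a≤r

  -- The first alternative of `ZSet` has `h * F a * (p a ^ s - 1)` elements and the second
  -- `h * (M a - F a)`. Adding `h * F a` twice avoids both subtractions.
  size-formula : ∀ a s h → 1 ≤ a → a ≤ r → n ≡ h * M a * p a ^ s →
    size a s + 2 * (h * F a) ≡ h * M a + h * F a * p a ^ s
  size-formula a s h 1≤a a≤r n≡h = begin
    size a s + 2 * g                  ≡⟨ cong (_+ 2 * g) (count-partition (low? a s) (high? a s) (zSet? a s) n
      (λ _ _ → inj₁) (λ _ _ → inj₂) (λ _ _ (miss , _) (hit , _) → miss hit) (λ _ _ → id)) ⟨
    lo + hi + 2 * g                   ≡⟨ shuffle lo hi g ⟩
    (hi + g) + (lo + g)               ≡⟨ cong₂ _+_ upper lower ⟩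
    h * M a + g * P                   ∎
    where
    open ≡-Reasoning
    P = p a ^ s
    g = h * F a
    lo = count (low? a s) n
    hi = count (high? a s) n
    shuffle : ∀ l h g → l + h + 2 * g ≡ (h + g) + (l + g)
    shuffle = solve-∀
    instance
      P≢0 : NonZero P
      P≢0 = m^n≢0 (p a) s {{prime⇒nonZero (prime a 1≤a a≤r)}}
    n≡P : n ≡ P * (h * M a)
    n≡P = trans n≡h (*-comm (h * M a) P)
    inv : Invariant P (Other a)
    inv = Invariant-^ (other-invariant a 1≤a a≤r) s
    hi≡ : hi ≡ count (other? a) (h * M a)
    hi≡ = begin
      hi                                                   ≡⟨ cong (count (high? a s)) n≡P ⟩
      count (high? a s) (P * (h * M a))                    ≡⟨ count-cong (high? a s) (λ x → P ∣? x ×-dec other? a x) (P * (h * M a))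
        (λ _ _ (o , d) → d , o) (λ _ _ (d , o) → o , d) ⟩
      count (λ x → P ∣? x ×-dec other? a x) (P * (h * M a)) ≡⟨ count-∣ (other? a) P (h * M a) inv ⟩
      count (other? a) (h * M a)                           ∎
    upper : hi + g ≡ h * M a
    upper = begin
      hi + g                                                       ≡⟨ cong₂ _+_ hi≡ (sym (count-noOther a h)) ⟩
      count (other? a) (h * M a) + count (noOther? a) (h * M a)    ≡⟨ count-complement (other? a) (h * M a) ⟩
      h * M a                                                      ∎
    mid? : Dec₁ (λ x → P ∣ x × ¬ Other a x)
    mid? x = P ∣? x ×-dec noOther? a x
    mid : count mid? n ≡ g
    mid = begin
      count mid? n                   ≡⟨ cong (count mid?) n≡P ⟩
      count mid? (P * (h * M a))     ≡⟨ count-∣ (noOther? a) P (h * M a) (Invariant-¬ {P} inv) ⟩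
      count (noOther? a) (h * M a)   ≡⟨ count-noOther a h ⟩
      g                              ∎
    lower : lo + g ≡ g * P
    lower = begin
      lo + g                          ≡⟨ cong (lo +_) mid ⟨
      lo + count mid? n               ≡⟨ count-partition (low? a s) mid? (noOther? a) n
        (λ _ _ → proj₁) (λ _ _ → proj₂) (λ _ _ (_ , ¬d) (d , _) → ¬d d) (λ x _ → either x) ⟩
      count (noOther? a) n            ≡⟨ cong (count (noOther? a)) (trans n≡P (sym (*-assoc P h (M a)))) ⟩
      count (noOther? a) (P * h * M a) ≡⟨ count-noOther a (P * h) ⟩
      P * h * F a                     ≡⟨ trans (*-assoc P h (F a)) (*-comm P g) ⟩
      g * P                           ∎
      where
      either : ∀ x → ¬ Other a x → ((¬ Other a x) × (¬ P ∣ x)) ⊎ (P ∣ x × ¬ Other a x)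
      either x miss with P ∣? x
      ... | yes d = inj₂ (d , miss)
      ... | no ¬d = inj₁ (miss , ¬d)

  unit? : Dec₁ (λ x → gcd x n ≡ 1)
  unit? x = gcd x n ≟ 1

  noHit⇒unit : ∀ x → ¬ Hit r (λ _ → Unit) p x → gcd x n ≡ 1
  noHit⇒unit x miss = Coprimality.coprime⇒gcd≡1 (subst (Coprime x)
    (trans (prod-cong r (λ i _ _ → refl)) (sym n≡))
    (miss⇒coprime (λ _ → yes tt) p e r x prime miss))

  unit⇒∤ : ∀ x i → 1 ≤ i → i ≤ r → gcd x n ≡ 1 → ¬ p i ∣ x
  unit⇒∤ x i 1≤i i≤r g≡1 d = ¬prime[1] (subst Prime
    (∣1⇒≡1 (subst (p i ∣_) g≡1 (gcd-greatest d (p∣n i 1≤i i≤r)))) (prime i 1≤i i≤r))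

  -- Units are the numbers divisible neither by `p a` nor by another prime of `n`. The first
  -- condition gives the factor `pred (p a)` by `count-∤`, the second is counted by periods.
  φ-formula : ∀ a s h → 1 ≤ a → a ≤ r → n ≡ h * M a * p a ^ suc s →
    φ n ≡ pred (p a) * (h * F a * p a ^ s)
  φ-formula a s h 1≤a a≤r n≡h = begin
    φ n                            ≡⟨ φ-count n ⟩
    count unit? n                  ≡⟨ count-cong unit? free? n to from ⟩
    count free? n                  ≡⟨ cong (count free?) n≡q ⟩
    count free? (suc q * (P * h * M a)) ≡⟨ count-∤ (noOther? a) q (P * h * M a)
      (Invariant-¬ {suc q} (subst (λ m → Invariant m (Other a)) (sym q≡) (other-invariant a 1≤a a≤r)))
      (M-periodic a (P * h)) ⟩
    q * count (noOther? a) (P * h * M a) ≡⟨ cong (q *_) (count-noOther a (P * h)) ⟩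
    q * (P * h * F a)              ≡⟨ cong (q *_) (trans (*-assoc P h (F a)) (*-comm P (h * F a))) ⟩
    q * (h * F a * P)              ∎
    where
    open ≡-Reasoning
    q = pred (p a)
    P = p a ^ s
    q≡ : suc q ≡ p a
    q≡ = suc-pred (p a) {{prime⇒nonZero (prime a 1≤a a≤r)}}
    free? : Dec₁ (λ x → (¬ suc q ∣ x) × ¬ Other a x)
    free? x = ¬? (suc q ∣? x) ×-dec noOther? a x
    shuffle : ∀ h M q P → h * M * (q * P) ≡ q * (P * h * M)
    shuffle = solve-∀
    n≡q : n ≡ suc q * (P * h * M a)
    n≡q = trans n≡h (trans (shuffle h (M a) (p a) P) (cong (_* (P * h * M a)) (sym q≡)))
    to : ∀ x → x < n → gcd x n ≡ 1 → (¬ suc q ∣ x) × ¬ Other a x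
    to x _ g≡1 = (λ d → unit⇒∤ x a 1≤a a≤r g≡1 (subst (_∣ x) q≡ d)) ,
      λ (i , i≤r , 1≤i , _ , d) → unit⇒∤ x i 1≤i (s≤s⁻¹ i≤r) g≡1 d
    from : ∀ x → x < n → (¬ suc q ∣ x) × (¬ Other a x) → gcd x n ≡ 1
    from x _ (¬d , miss) = noHit⇒unit x λ (i , i≤r , 1≤i , _ , d) → case i ≟ a of λ where
      (yes refl) → ¬d (subst (_∣ x) (sym q≡) d)
      (no i≢a)   → miss (i , i≤r , 1≤i , i≢a , d)

  M≡÷ : ∀ a → 1 ≤ a → a ≤ r → prod p r ÷ p a ≡ M a
  M≡÷ a 1≤a a≤r = trans (cong (_÷ p a) (trans (prod≡ a 1≤a a≤r) (*-comm (p a) (M a))))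
    (÷-exact (M a) (p a) {{prime⇒nonZero (prime a 1≤a a≤r)}})

  φM≡F : ∀ a → φ (M a) ≡ F a
  φM≡F a = φ-prod (except? a) p r prime distinct

  size≡β : ∀ a s → 1 ≤ a → a ≤ r → 2 ≤ s → s ≤ e a → size a s ≡ β n r p a s
  size≡β a s@(suc s′) 1≤a a≤r (s≤s 1≤s′) s≤e = from-scale (scale a s 1≤a a≤r s≤e)
    where
    open ≡-Reasoning
    w = p a ^ s′
    v = w ∸ 2
    q = pred (p a)
    instance
      p≢0 : NonZero (p a)
      p≢0 = prime⇒nonZero (prime a 1≤a a≤r)
    q≡ : suc q ≡ p a
    q≡ = suc-pred (p a)
    -- Since `s ≥ 2`, `w` is at least 2, so the truncated subtraction in `β` is exact.
    w≡ : 2 + v ≡ w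
    w≡ = m+[n∸m]≡n (≤-trans (p≥2 a 1≤a a≤r) (subst (_≤ w) (^-identityʳ (p a)) (^-monoʳ-≤ (p a) 1≤s′)))
    h≡ : ∀ h → n ≡ h * M a * p a ^ s → n ÷ (prod p r * w) ≡ h
    h≡ h n≡h = trans (cong (_÷ (prod p r * w)) (trans n≡h (trans (shuffle h (M a) (p a) w)
           (cong (λ m → h * (m * w)) (sym (prod≡ a 1≤a a≤r))))))
         (÷-exact h (prod p r * w) {{m*n≢0 (prod p r) w {{>-nonZero (prod-positive r p≥1)}} {{m^n≢0 (p a) s′}}}})
      where
      shuffle : ∀ h M p w → h * M * (p * w) ≡ h * (p * M * w)
      shuffle = solve-∀
    β≡ : ∀ h → n ≡ h * M a * p a ^ s → β n r p a s ≡ q * (h * F a * w) + h * (M a + F a * v)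
    β≡ h n≡h = cong₂ _+_ (φ-formula a s′ h 1≤a a≤r n≡h) (cong₂ _*_ (h≡ h n≡h) (cong₂ _+_ (M≡÷ a 1≤a a≤r)
      (cong (_* v) (trans (cong φ (M≡÷ a 1≤a a≤r)) (φM≡F a)))))
    expand : ∀ h M F q v → h * M + h * F * (suc q * (2 + v)) ≡
      q * (h * F * (2 + v)) + h * (M + F * v) + 2 * (h * F)
    expand = solve-∀
    collect : ∀ h M F q v P W → P ≡ suc q → W ≡ 2 + v → h * M + h * F * (P * W) ≡
      q * (h * F * W) + h * (M + F * v) + 2 * (h * F)
    collect h M F q v _ _ refl refl = expand h M F q v
    from-scale : (∃ λ h → 1 ≤ h × n ≡ h * M a * p a ^ s) → size a s ≡ β n r p a s
    from-scale (h , _ , n≡h) = trans (+-cancelʳ-≡ (2 * (h * F a)) (size a s) (q * (h * F a * w) + h * (M a + F a * v))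
      (trans (size-formula a s h 1≤a a≤r n≡h) (collect h (M a) (F a) q v (p a) w (sym q≡) (sym w≡))))
      (sym (β≡ h n≡h))

  -- Here `D` is `M a - 2 * F a`, which absorbs the subtraction of `size-formula`. As `h * p a ^ s`
  -- is `n / M a`, the second summand does not depend on `s`.
  size-excess : ∀ a s h D → 1 ≤ a → a ≤ r → n ≡ h * M a * p a ^ s → M a ≡ 2 * F a + D →
    size a s ≡ h * D + h * F a * p a ^ s
  size-excess a s h D 1≤a a≤r n≡h M≡ = +-cancelʳ-≡ (2 * (h * F a)) _ _ (begin
    size a s + 2 * (h * F a)                       ≡⟨ size-formula a s h 1≤a a≤r n≡h ⟩
    h * M a + h * F a * p a ^ s                    ≡⟨ cong (λ m → h * m + h * F a * p a ^ s) M≡ ⟩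
    h * (2 * F a + D) + h * F a * p a ^ s          ≡⟨ shuffle h (F a) D (p a ^ s) ⟩
    h * D + h * F a * p a ^ s + 2 * (h * F a)      ∎)
    where
    open ≡-Reasoning
    shuffle : ∀ h F D P → h * (2 * F + D) + h * F * P ≡ h * D + h * F * P + 2 * (h * F)
    shuffle = solve-∀

  -- Passing from `s′` down to `s` multiplies the cofactor `h` by some `k ≥ 2`, which changes only
  -- the positive first summand of `size-excess`.
  size-decreasing : ∀ a s s′ → 1 ≤ a → a ≤ r → s < s′ → s′ ≤ e a → 2 * F a < M a → size a s′ < size a s
  size-decreasing a s s′ 1≤a a≤r s<s′ s′≤e 2F<M =
    let h , h≥1 , n≡h = scale a s′ 1≤a a≤r s′≤e
        d , M≡        = <⇒excess 2F<M
    in shrink h h≥1 n≡h d M≡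
    where
    open ≤-Reasoning
    k = p a ^ (s′ ∸ s)
    split : p a ^ s′ ≡ k * p a ^ s
    split = trans (cong (p a ^_) (sym (m∸n+n≡m (<⇒≤ s<s′)))) (^-distribˡ-+-* (p a) (s′ ∸ s) s)
    shuffle : ∀ k h D F P → k * (h * D) + h * F * (k * P) ≡ h * k * D + h * k * F * P
    shuffle = solve-∀
    shuffle′ : ∀ k h M P → h * M * (k * P) ≡ h * k * M * P
    shuffle′ = solve-∀
    k≥2 : 2 ≤ k
    k≥2 = ≤-trans (p≥2 a 1≤a a≤r) (subst (_≤ k) (^-identityʳ (p a))
      (^-monoʳ-≤ (p a) {{prime⇒nonZero (prime a 1≤a a≤r)}} (m<n⇒0<n∸m s<s′)))
    hd<khd : ∀ h d → 1 ≤ h → h * suc d < k * (h * suc d)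
    hd<khd h d h≥1 = subst (_< k * (h * suc d)) (*-identityˡ (h * suc d))
      (*-monoˡ-< (h * suc d) {{>-nonZero (*-mono-≤ h≥1 (s≤s z≤n))}} k≥2)
    shrink : ∀ h → 1 ≤ h → n ≡ h * M a * p a ^ s′ → ∀ d → M a ≡ 2 * F a + suc d → size a s′ < size a s
    shrink h h≥1 n≡h d M≡ = begin-strict
      size a s′                                ≡⟨ size-excess a s′ h (suc d) 1≤a a≤r n≡h M≡ ⟩
      h * suc d + h * F a * p a ^ s′           <⟨ +-monoˡ-< (h * F a * p a ^ s′) (hd<khd h d h≥1) ⟩
      k * (h * suc d) + h * F a * p a ^ s′     ≡⟨ cong (λ m → k * (h * suc d) + h * F a * m) split ⟩
      k * (h * suc d) + h * F a * (k * p a ^ s) ≡⟨ shuffle k h (suc d) (F a) (p a ^ s) ⟩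
      h * k * suc d + h * k * F a * p a ^ s    ≡⟨ size-excess a s (h * k) (suc d) 1≤a a≤r
        (trans n≡h (trans (cong (h * M a *_) split) (shuffle′ k h (M a) (p a ^ s)))) M≡ ⟨
      size a s                                 ∎

  -- Coatom classes and elements divisible by primes from two sides

  coatom? : ∀ i → Dec₁ (λ x → gcd x n ≡ p i)
  coatom? i x = gcd x n ≟ p i

  -- Units modulo `n` are units modulo `n₁ = n / p i`, and the latter occur `p i` times as often
  -- below `n` as below `n₁`. Multiplication by `p i` carries those below `n₁` into the coatom
  -- class.
  coatom-bound : ∀ i → 1 ≤ i → i ≤ r → φ n ≤ p i * count (coatom? i) n
  coatom-bound i 1≤i i≤r with divides n₁ n≡n₁ ← p∣n i 1≤i i≤r = begin
    φ n                           ≡⟨ φ-count n ⟩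
    count unit? n                 ≤⟨ count-mono unit? unit₁? n to-unit₁ ⟩
    count unit₁? n                ≡⟨ cong (count unit₁?) (trans n≡n₁ (*-comm n₁ (p i))) ⟩
    count unit₁? (p i * n₁)       ≡⟨ count-periodic unit₁? n₁ periodic (p i) ⟩
    p i * count unit₁? n₁         ≤⟨ *-monoʳ-≤ (p i) (count-mono unit₁? (λ y → coatom? i (p i * y)) n₁ scaled) ⟩
    p i * count (λ y → coatom? i (p i * y)) n₁ ≡⟨ cong (p i *_) (count-multiples (coatom? i) (p i) n₁) ⟨
    p i * count (λ x → p i ∣? x ×-dec coatom? i x) (p i * n₁) ≡⟨ cong (λ m → p i * count (λ x → p i ∣? x ×-dec coatom? i x) m) n≡p ⟨
    p i * count (λ x → p i ∣? x ×-dec coatom? i x) n ≤⟨ *-monoʳ-≤ (p i) (count-mono (λ x → p i ∣? x ×-dec coatom? i x) (coatom? i) n (λ _ _ → proj₂)) ⟩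
    p i * count (coatom? i) n     ∎
    where
    open ≤-Reasoning
    instance
      p≢0 : NonZero (p i)
      p≢0 = prime⇒nonZero (prime i 1≤i i≤r)
    n≡p : n ≡ p i * n₁
    n≡p = trans n≡n₁ (*-comm n₁ (p i))
    unit₁? : Dec₁ (λ x → gcd x n₁ ≡ 1)
    unit₁? x = gcd x n₁ ≟ 1
    to-unit₁ : ∀ x → x < n → gcd x n ≡ 1 → gcd x n₁ ≡ 1
    to-unit₁ x _ g≡1 = ∣1⇒≡1 (subst (gcd x n₁ ∣_) g≡1 (gcd-greatest (gcd[m,n]∣m x n₁)
      (subst (gcd x n₁ ∣_) (sym n≡n₁) (∣m⇒∣m*n (p i) (gcd[m,n]∣n x n₁)))))
    gcd-shift : ∀ x → gcd (n₁ + x) n₁ ≡ gcd x n₁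
    gcd-shift x = ∣-antisym
      (gcd-greatest (∣m+n∣m⇒∣n (gcd[m,n]∣m (n₁ + x) n₁) (gcd[m,n]∣n (n₁ + x) n₁)) (gcd[m,n]∣n (n₁ + x) n₁))
      (gcd-greatest (∣m∣n⇒∣m+n (gcd[m,n]∣n x n₁) (gcd[m,n]∣m x n₁)) (gcd[m,n]∣n x n₁))
    periodic : Periodic n₁ (λ x → gcd x n₁ ≡ 1)
    periodic x = trans (gcd-shift x) , trans (sym (gcd-shift x))
    scaled : ∀ y → y < n₁ → gcd y n₁ ≡ 1 → gcd (p i * y) n ≡ p i
    scaled y _ g≡1 = trans (cong (gcd (p i * y)) n≡p) (trans (sym (c*gcd[m,n]≡gcd[cm,cn] (p i) y n₁))
      (trans (cong (p i *_) g≡1) (*-identityʳ (p i))))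

  -- Replacing the block of indices K by the single index r does not increase
  -- the number of elements divisible by primes from both sides.
  count-both-sides : ∀ {K} (K? : Dec₁ K) i h → n ≡ h * M r * p r ^ 2 → 1 ≤ i → i < r → K i → ¬ K r →
    count (high? r 1) n ≤ count (λ x → hit? r K? p x ×-dec hit? r (λ j → ¬? (K? j)) p x) n
  count-both-sides {K} K? i h n≡h 1≤i i<r Ki ¬Kr = begin
    -- Multiples of `p r` with a prime in `K` are already divisible by primes from both sides. The
    -- others are exchanged for nonmultiples of `p r` that have primes from both sides.
    count (high? r 1) n                     ≤⟨ count-cover qA? qB? (high? r 1) n high⇒ ⟩
    count qA? n + count qB? n               ≤⟨ +-monoʳ-≤ (count qA? n) exchange ⟩
    count qA? n + count q̸AB? n              ≤⟨ count-disjoint qA? q̸AB? both? n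
      (λ x _ (d , a) → a , (r , ≤-refl , 1≤r , ¬Kr , subst (_∣ x) q≡ d))
      (λ x _ (_ , a , b) → a , B⇒ b) (λ _ _ (d , _) (¬d , _) → ¬d d) ⟩
    count both? n                           ∎
    where
    open ≤-Reasoning
    1≤r = ≤-trans 1≤i (<⇒≤ i<r)
    i≤r = <⇒≤ i<r
    i≢r = <⇒≢ i<r
    q = pred (p r)
    q≡ : suc q ≡ p r
    q≡ = suc-pred (p r) {{prime⇒nonZero (prime r 1≤r ≤-refl)}}
    u = pred (p i)
    u≡ : suc u ≡ p i
    u≡ = suc-pred (p i) {{prime⇒nonZero (prime i 1≤i i≤r)}}
    J? : Dec₁ (λ j → (¬ K j) × j ≢ r)
    J? j = ¬? (K? j) ×-dec except? r j
    A B : ℕ → Set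
    A = Hit r K p
    B = Hit r (λ j → (¬ K j) × j ≢ r) p
    A? : Dec₁ A
    A? = hit? r K? p
    B? : Dec₁ B
    B? = hit? r J? p
    both? : Dec₁ (λ x → A x × Hit r (λ j → ¬ K j) p x)
    both? x = A? x ×-dec hit? r (λ j → ¬? (K? j)) p x
    qA? : Dec₁ (λ x → suc q ∣ x × A x)
    qA? x = suc q ∣? x ×-dec A? x
    āB? : Dec₁ (λ x → (¬ A x) × B x)
    āB? x = ¬? (A? x) ×-dec B? x
    AB? : Dec₁ (λ x → A x × B x)
    AB? x = A? x ×-dec B? x
    qB? : Dec₁ (λ x → suc q ∣ x × (¬ A x) × B x)
    qB? x = suc q ∣? x ×-dec āB? x
    q̸AB? : Dec₁ (λ x → (¬ suc q ∣ x) × A x × B x)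
    q̸AB? x = ¬? (suc q ∣? x) ×-dec AB? x
    B⇒ : ∀ {x} → B x → Hit r (λ j → ¬ K j) p x
    B⇒ (j , j≤r , 1≤j , (¬Kj , _) , d) = j , j≤r , 1≤j , ¬Kj , d
    high⇒ : ∀ x → x < n → Other r x × p r ^ 1 ∣ x → (suc q ∣ x × A x) ⊎ (suc q ∣ x × (¬ A x) × B x)
    high⇒ x _ ((j , j≤r , 1≤j , j≢r , d) , q∣x) with A? x | K? j
    ... | yes a | _      = inj₁ (subst (_∣ x) (trans (^-identityʳ (p r)) (sym q≡)) q∣x , a)
    ... | no ¬a | yes Kj = contradiction (j , j≤r , 1≤j , Kj , d) ¬a
    ... | no ¬a | no ¬Kj = inj₂ (subst (_∣ x) (trans (^-identityʳ (p r)) (sym q≡)) q∣x , ¬a ,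
      (j , j≤r , 1≤j , (¬Kj , j≢r) , d))
    N₂ = prod (sel (except₂? r i) p) r
    -- This is `n / (p r * p i)`. It keeps every prime counted in `B`, so it is still a period of
    -- `B`.
    L′ = p r * h * N₂
    L = suc u * L′
    M≡ : M r ≡ p i * N₂
    M≡ = prod-except₂ p r i r i≢r 1≤i i≤r
    n≡L : n ≡ suc q * L
    n≡L = trans n≡h (trans (cong (λ m → h * m * p r ^ 2) M≡) (trans (shuffle h (p i) N₂ (p r))
      (sym (cong₂ (λ Q U → Q * (U * L′)) q≡ u≡))))
      where
      shuffle : ∀ h u N q → h * (u * N) * (q * (q * 1)) ≡ q * (u * (q * h * N))
      shuffle = solve-∀
    pj∣L : ∀ j → 1 ≤ j → j ≤ r → p j ∣ L
    pj∣L j 1≤j j≤r with j ≟ r | j ≟ i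
    ... | yes refl | _        = ∣n⇒∣m*n (suc u) (∣m⇒∣m*n N₂ (m∣m*n h))
    ... | no _     | yes refl = subst (_∣ L) u≡ (m∣m*n L′)
    ... | no j≢r   | no j≢i   = ∣n⇒∣m*n (suc u) (∣n⇒∣m*n (p r * h)
      (factor-∣-sel (except₂? r i) p r j 1≤j j≤r (j≢r , j≢i)))
    A-periodic : Periodic L A
    A-periodic = hit-periodic λ j 1≤j j≤r _ → pj∣L j 1≤j j≤r
    B-periodic : Periodic L B
    B-periodic = hit-periodic λ j 1≤j j≤r _ → pj∣L j 1≤j j≤r
    B-periodic′ : Periodic L′ B
    B-periodic′ = hit-periodic λ j 1≤j j≤r (¬Kj , j≢r) → ∣n⇒∣m*n (p r * h)
      (factor-∣-sel (except₂? r i) p r j 1≤j j≤r (j≢r , λ { refl → ¬Kj Ki }))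
    A-invariant : Invariant (suc q) A
    A-invariant = subst (λ m → Invariant m A) (sym q≡) (hit-invariant (prime r 1≤r ≤-refl) prime
      λ j 1≤j j≤r Kj pj≡ → ¬Kr (subst K (distinct j r 1≤j j≤r 1≤r ≤-refl pj≡) Kj))
    B-invariant : Invariant (suc q) B
    B-invariant = subst (λ m → Invariant m B) (sym q≡) (hit-invariant (prime r 1≤r ≤-refl) prime
      λ j 1≤j j≤r (_ , j≢r) pj≡ → j≢r (distinct j r 1≤j j≤r 1≤r ≤-refl pj≡))
    B-invariant′ : Invariant (suc u) B
    B-invariant′ = subst (λ m → Invariant m B) (sym u≡) (hit-invariant (prime i 1≤i i≤r) prime
      λ j 1≤j j≤r (¬Kj , _) pj≡ → ¬Kj (subst K (sym (distinct j i 1≤j j≤r 1≤i i≤r pj≡)) Ki))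
    ×-invariant : ∀ {m P Q} → Invariant m P → Invariant m Q → Invariant m (λ x → P x × Q x)
    ×-invariant f g x = (λ (a , b) → proj₁ (f x) a , proj₁ (g x) b) ,
                        (λ (a , b) → proj₂ (f x) a , proj₂ (g x) b)
    ×-periodic : ∀ {m P Q} → Periodic m P → Periodic m Q → Periodic m (λ x → P x × Q x)
    ×-periodic f g x = (λ (a , b) → proj₁ (f x) a , proj₁ (g x) b) ,
                       (λ (a , b) → proj₂ (f x) a , proj₂ (g x) b)
    uB? : Dec₁ (λ x → suc u ∣ x × B x)
    uB? x = suc u ∣? x ×-dec B? x
    u̸B? : Dec₁ (λ x → (¬ suc u ∣ x) × B x)
    u̸B? x = ¬? (suc u ∣? x) ×-dec B? x
    A-from-u : ∀ x → suc u ∣ x → A x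
    A-from-u x d = i , s≤s i≤r , 1≤i , Ki , subst (_∣ x) u≡ d
    -- Both counts are compared with `count B? L′`: the left is at most `p i - 1` times it, the
    -- right at least `p r - 1` times it.
    exchange : count qB? n ≤ count q̸AB? n
    exchange = begin
      count qB? n                ≡⟨ cong (count qB?) n≡L ⟩
      count qB? (suc q * L)      ≡⟨ count-∣ āB? (suc q) L (×-invariant {suc q} (Invariant-¬ {suc q} A-invariant) B-invariant) ⟩
      count āB? L                ≤⟨ count-mono āB? u̸B? L (λ x _ (¬a , b) → ¬a ∘ A-from-u x , b) ⟩
      count u̸B? L                ≡⟨ count-∤ B? u L′ B-invariant′ B-periodic′ ⟩
      u * count B? L′            ≤⟨ *-monoˡ-≤ (count B? L′) (pred-mono-≤ (<⇒≤ (increasing i r 1≤i i<r ≤-refl))) ⟩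
      q * count B? L′            ≡⟨ cong (q *_) (count-∣ B? (suc u) L′ B-invariant′) ⟨
      q * count uB? L            ≤⟨ *-monoʳ-≤ q (count-mono uB? AB? L (λ x _ (d , b) → A-from-u x d , b)) ⟩
      q * count AB? L            ≡⟨ count-∤ AB? q L (×-invariant {suc q} A-invariant B-invariant) (×-periodic {L} A-periodic B-periodic) ⟨
      count q̸AB? (suc q * L)     ≡⟨ cong (count q̸AB?) n≡L ⟨
      count q̸AB? n               ∎

  -- Lower bounds exceeding `size r 2`

  suc-pred-p : ∀ a → 1 ≤ a → a ≤ r → suc (pred (p a)) ≡ p a
  suc-pred-p a 1≤a a≤r = suc-pred (p a) {{prime⇒nonZero (prime a 1≤a a≤r)}}

  increasing-≤ : ∀ i → 1 ≤ i → i ≤ r → p i ≤ p r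
  increasing-≤ i 1≤i i≤r with i ≟ r
  ... | yes refl = ≤-refl
  ... | no i≢r   = <⇒≤ (increasing i r 1≤i (≤∧≢⇒< i≤r i≢r) ≤-refl)

  module _ (h : ℕ) (h≥1 : 1 ≤ h) (n≡h : n ≡ h * M r * p r ^ 2) (1≤r : 1 ≤ r) (2≤e : 2 ≤ e r)
           (2F<M : 2 * F r < M r) where

    private
      q = pred (p r)
      q≡ : suc q ≡ p r
      q≡ = suc-pred-p r 1≤r ≤-refl
      g = h * F r

    φ≡ : φ n ≡ q * (g * suc q)
    φ≡ = trans (φ-formula r 1 h 1≤r ≤-refl n≡h)
      (cong (λ m → q * (g * m)) (trans (^-identityʳ (p r)) (sym q≡)))

    p²≡ : p r ^ 2 ≡ suc q * suc q
    p²≡ = trans (cong (p r *_) (*-identityʳ (p r))) (cong₂ _*_ (sym q≡) (sym q≡))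

    -- The set counted by `size r 1` consists of generators and of `high? r 1`; `count-both-sides`
    -- replaces the latter, and `size r 2` is smaller than `size r 1`.
    two-sided-bound : ∀ {K} (K? : Dec₁ K) i → 1 ≤ i → i < r → K i → ¬ K r →
      size r 2 < φ n + count (λ x → hit? r K? p x ×-dec hit? r (λ j → ¬? (K? j)) p x) n
    two-sided-bound K? i 1≤i i<r Ki ¬Kr = begin-strict
      size r 2                                    <⟨ size-decreasing r 1 2 1≤r ≤-refl ≤-refl 2≤e 2F<M ⟩
      size r 1                                    ≤⟨ count-cover (low? r 1) (high? r 1) (zSet? r 1) n (λ _ _ → id) ⟩
      count (low? r 1) n + count (high? r 1) n    ≤⟨ +-mono-≤
        (≤-trans (count-mono (low? r 1) unit? n low⇒unit) (≤-reflexive (sym (φ-count n))))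
        (count-both-sides K? i h n≡h 1≤i i<r Ki ¬Kr) ⟩
      φ n + count (λ x → hit? r K? p x ×-dec hit? r (λ j → ¬? (K? j)) p x) n ∎
      where
      open ≤-Reasoning
      low⇒unit : ∀ x → x < n → (¬ Other r x) × (¬ p r ^ 1 ∣ x) → gcd x n ≡ 1
      low⇒unit x _ (miss , ¬d) = noHit⇒unit x λ (i , i≤r , 1≤i , _ , d) → case i ≟ r of λ where
        (yes refl) → ¬d (subst (_∣ x) (sym (^-identityʳ (p r))) d)
        (no i≢r)   → miss (i , i≤r , 1≤i , i≢r , d)

    coatom-≥ : ∀ i → 1 ≤ i → i ≤ r → q * g ≤ count (coatom? i) n
    coatom-≥ i 1≤i i≤r = *-cancelˡ-≤ (suc q) (begin
      suc q * (q * g)                 ≡⟨ shuffle q g ⟩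
      q * (g * suc q)                 ≡⟨ φ≡ ⟨
      φ n                             ≤⟨ coatom-bound i 1≤i i≤r ⟩
      p i * count (coatom? i) n       ≤⟨ *-monoˡ-≤ (count (coatom? i) n) (increasing-≤ i 1≤i i≤r) ⟩
      p r * count (coatom? i) n       ≡⟨ cong (_* count (coatom? i) n) q≡ ⟨
      suc q * count (coatom? i) n     ∎)
      where
      open ≤-Reasoning
      shuffle : ∀ q g → suc q * (q * g) ≡ q * (g * suc q)
      shuffle = solve-∀

    -- For `i < r` the divisor in `coatom-bound` is at most `p r - 1`, which improves on `coatom-≥`.
    coatom-≥′ : ∀ i → 1 ≤ i → i < r → g * suc q ≤ count (coatom? i) n
    coatom-≥′ i 1≤i i<r = *-cancelˡ-≤ q {{>-nonZero (pred-mono-≤ (p≥2 r 1≤r ≤-refl))}} (begin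
      q * (g * suc q)                 ≡⟨ φ≡ ⟨
      φ n                             ≤⟨ coatom-bound i 1≤i (<⇒≤ i<r) ⟩
      p i * count (coatom? i) n       ≤⟨ *-monoˡ-≤ (count (coatom? i) n) (pred-mono-≤ (increasing i r 1≤i i<r ≤-refl)) ⟩
      q * count (coatom? i) n         ∎)
      where open ≤-Reasoning

    -- `φ n` and the two coatom bounds add up to `g * p r ^ 2 + q * g`, while `size r 2` is
    -- `g * p r ^ 2 + h * D`. So `D < q * F r` suffices.
    two-coatom-bound : ∀ i j → 1 ≤ i → i < j → j ≤ r →
      size r 2 < φ n + (count (coatom? i) n + count (coatom? j) n)
    two-coatom-bound i j 1≤i i<j j≤r = begin-strict
      size r 2                                ≡⟨ size-excess r 2 h D 1≤r ≤-refl n≡h M≡ ⟩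
      h * D + g * p r ^ 2                     ≡⟨ cong (λ m → h * D + g * m) p²≡ ⟩
      h * D + g * (suc q * suc q)             <⟨ +-monoˡ-< (g * (suc q * suc q)) hD< ⟩
      h * (q * F r) + g * (suc q * suc q)     ≡⟨ shuffle h (F r) q ⟩
      q * (g * suc q) + (g * suc q + q * g)   ≡⟨ cong (_+ (g * suc q + q * g)) φ≡ ⟨
      φ n + (g * suc q + q * g)               ≤⟨ +-monoʳ-≤ (φ n) (+-mono-≤
        (coatom-≥′ i 1≤i (≤-trans i<j j≤r)) (coatom-≥ j (≤-trans 1≤i (<⇒≤ i<j)) j≤r)) ⟩
      φ n + (count (coatom? i) n + count (coatom? j) n) ∎
      where
      open ≤-Reasoning
      D = M r ∸ 2 * F r
      M≡ : M r ≡ 2 * F r + D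
      M≡ = sym (m+[n∸m]≡n (<⇒≤ 2F<M))
      -- Leaving out `r` keeps the factor of `prod-≤-selected` at most `r`, and `r ≤ q` because
      -- `r < p r`.
      M≤ : M r ≤ q * F r
      M≤ = begin
        M r                                    ≤⟨ prod-≤-selected (except? r) p r p>index ⟩
        suc (selected (except? r) r) * F r     ≤⟨ *-monoˡ-≤ (F r) (≤-trans
          (selected-< (except? r) r r 1≤r ≤-refl (λ r≢r → r≢r refl)) (pred-mono-≤ (p>index r 1≤r ≤-refl))) ⟩
        q * F r                                ∎
      D< : D < q * F r
      D< = begin-strict
        D                 <⟨ m<n+m D (≤-trans (F≥1 r) (m≤m+n (F r) _)) ⟩
        2 * F r + D       ≡⟨ M≡ ⟨
        M r               ≤⟨ M≤ ⟩
        q * F r           ∎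
      hD< : h * D < h * (q * F r)
      hD< = *-monoʳ-< h {{>-nonZero h≥1}} D<
      shuffle : ∀ h F q → h * (q * F) + h * F * (suc q * suc q) ≡
        q * (h * F * suc q) + (h * F * suc q + q * (h * F))
      shuffle = solve-∀

    -- There are `n / (p i * p j)` such multiples, `h * M r` is `n / p r ^ 2`, and
    -- `p i * p j < p r ^ 2`.
    multiples-bound : ∀ i j → 1 ≤ i → i < j → j ≤ r →
      h * M r < count (λ x → p i * p j ∣? x) n
    multiples-bound i j 1≤i i<j j≤r with divides c n≡c ← p^∣n j 1 (≤-trans 1≤i (<⇒≤ i<j)) j≤r (e≥1 j (≤-trans 1≤i (<⇒≤ i<j)) j≤r)
                                       | divides k n≡k ← pp^∣n i j 1 1≤i (≤-trans (<⇒≤ i<j) j≤r) (≤-trans 1≤i (<⇒≤ i<j)) j≤r (<⇒≢ i<j) (e≥1 j (≤-trans 1≤i (<⇒≤ i<j)) j≤r)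
      = begin-strict
      h * M r                             <⟨ *-cancelʳ-< (p r ^ 2) (h * M r) k (begin-strict
        h * M r * p r ^ 2                   ≡⟨ n≡h ⟨
        n                                   ≡⟨ n≡k′ ⟩
        k * m                               <⟨ *-monoʳ-< k {{k≢0}} m<p² ⟩
        k * p r ^ 2                         ∎) ⟩
      k                                   ≡⟨ count-full (λ _ → yes tt) k (λ _ _ → tt) ⟨
      count (λ _ → yes tt) k              ≡⟨ count-∣ (λ _ → yes tt) m {{m≢0}} k (λ _ → id , id) ⟨
      count (λ x → m ∣? x ×-dec yes tt) (m * k) ≤⟨ count-mono (λ x → m ∣? x ×-dec yes tt) (m ∣?_) (m * k) (λ _ _ → proj₁) ⟩
      count (m ∣?_) (m * k)               ≡⟨ cong (count (m ∣?_)) (trans (*-comm m k) (sym n≡k′)) ⟩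
      count (m ∣?_) n                     ∎
      where
      open ≤-Reasoning
      m = p i * p j
      1≤j = ≤-trans 1≤i (<⇒≤ i<j)
      i≤r = ≤-trans (<⇒≤ i<j) j≤r
      n≡k′ : n ≡ k * m
      n≡k′ = trans n≡k (cong (λ z → k * (p i * z)) (^-identityʳ (p j)))
      m≢0 : NonZero m
      m≢0 = m*n≢0 (p i) (p j) {{prime⇒nonZero (prime i 1≤i i≤r)}} {{prime⇒nonZero (prime j 1≤j j≤r)}}
      k≢0 : NonZero k
      k≢0 = ≢-nonZero λ k≡0 → contradiction (trans n≡k′ (cong (_* m) k≡0)) (>⇒≢ n≥1)
      m<p² : m < p r ^ 2
      m<p² = subst (m <_) (cong (p r *_) (sym (*-identityʳ (p r)))) (begin-strict
        p i * p j <⟨ *-monoˡ-< (p j) {{prime⇒nonZero (prime j 1≤j j≤r)}} (increasing i r 1≤i (≤-trans i<j j≤r) ≤-refl) ⟩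
        p r * p j ≤⟨ *-monoʳ-≤ (p r) (increasing-≤ j 1≤j j≤r) ⟩
        p r * p r ∎)

    -- After `2 * g` is added to both sides, `size-formula` leaves `h * M r` to be compared with the
    -- multiples of `p i * p j`, and the terms in `g` have a surplus of one `g`.
    coatom-multiples-bound : ∀ a i j → 1 ≤ a → a ≤ r → 1 ≤ i → i < j → j ≤ r →
      size r 2 < φ n + (count (coatom? a) n + count (λ x → p i * p j ∣? x) n)
    coatom-multiples-bound a i j 1≤a a≤r 1≤i i<j j≤r = +-cancelʳ-< (2 * g) _ _ (begin-strict
      size r 2 + 2 * g                             ≡⟨ size-formula r 2 h 1≤r ≤-refl n≡h ⟩
      h * M r + g * p r ^ 2                        <⟨ +-monoˡ-< (g * p r ^ 2) (multiples-bound i j 1≤i i<j j≤r) ⟩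
      c + g * p r ^ 2                              ≡⟨ cong (λ m → c + g * m) p²≡ ⟩
      c + g * (suc q * suc q)                      ≤⟨ m≤m+n _ g ⟩
      c + g * (suc q * suc q) + g                  ≡⟨ shuffle c g q ⟩
      q * (g * suc q) + (q * g + c) + 2 * g        ≡⟨ cong (λ m → m + (q * g + c) + 2 * g) φ≡ ⟨
      φ n + (q * g + c) + 2 * g                    ≤⟨ +-monoˡ-≤ (2 * g) (+-monoʳ-≤ (φ n) (+-monoˡ-≤ c (coatom-≥ a 1≤a a≤r))) ⟩
      φ n + (count (coatom? a) n + c) + 2 * g      ∎)
      where
      open ≤-Reasoning
      c = count (λ x → p i * p j ∣? x) n
      shuffle : ∀ c g q → c + g * (suc q * suc q) + g ≡ q * (g * suc q) + (q * g + c) + 2 * g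
      shuffle = solve-∀

    -- The part `2 * F r` of `M r` contributes equally to `n` and to twice the size. The excess
    -- contributes to `n` with factor `p r ^ 2` and to twice the size only with factor 2.
    size-below-half : 2 * size r 2 < n
    size-below-half with d , M≡ ← <⇒excess 2F<M = begin-strict
      2 * size r 2                            ≡⟨ cong (2 *_) (size-excess r 2 h (suc d) 1≤r ≤-refl n≡h M≡) ⟩
      2 * (h * suc d + g * p r ^ 2)           ≡⟨ expand h (suc d) (F r) (p r ^ 2) ⟩
      h * suc d * 2 + h * (2 * F r) * p r ^ 2 <⟨ +-monoˡ-< (h * (2 * F r) * p r ^ 2) (*-monoʳ-< (h * suc d)
                                                 {{m*n≢0 h (suc d) {{>-nonZero h≥1}}}} 2<p²) ⟩
      h * suc d * p r ^ 2 + h * (2 * F r) * p r ^ 2 ≡⟨ collect h (suc d) (2 * F r) (p r ^ 2) ⟩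
      h * (2 * F r + suc d) * p r ^ 2         ≡⟨ cong (λ m → h * m * p r ^ 2) M≡ ⟨
      h * M r * p r ^ 2                       ≡⟨ n≡h ⟨
      n                                       ∎
      where
      open ≤-Reasoning
      2<p² : 2 < p r ^ 2
      2<p² = ≤-trans (s≤s (s≤s (s≤s z≤n))) (subst (4 ≤_) (cong (p r *_) (sym (*-identityʳ (p r))))
        (*-mono-≤ (p≥2 r 1≤r ≤-refl) (p≥2 r 1≤r ≤-refl)))
      expand : ∀ h D F P → 2 * (h * D + h * F * P) ≡ h * D * 2 + h * (2 * F) * P
      expand = solve-∀
      collect : ∀ h D F P → h * D * P + h * F * P ≡ h * (F + D) * P
      collect = solve-∀

  -- With `D = 2 * F a - M a` the difference `2 * size a t - n` equals `h * D * (p a ^ t - 2)`.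
  size-above-half : ∀ a t → 1 ≤ a → a ≤ r → 1 ≤ t → t ≤ e a → M a ≤ 2 * F a → n ≤ 2 * size a t
  size-above-half a t 1≤a a≤r 1≤t t≤e M≤2F =
    let h , _ , n≡h = scale a t 1≤a a≤r t≤e
        v , w≡      = m≤n⇒∃[o]m+o≡n 2≤w
    in halve h n≡h v w≡
    where
    open ≤-Reasoning
    w = p a ^ t
    2≤w : 2 ≤ w
    2≤w = ≤-trans (p≥2 a 1≤a a≤r) (subst (_≤ w) (^-identityʳ (p a))
      (^-monoʳ-≤ (p a) {{prime⇒nonZero (prime a 1≤a a≤r)}} 1≤t))
    D = 2 * F a ∸ M a
    arith : ∀ h M F D v w → M + D ≡ 2 * F → 2 + v ≡ w →
      h * M * w + h * D * v + 2 * (2 * (h * F)) ≡ 2 * (h * M + h * F * w)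
    arith h M F D v w eq refl = begin-equality
      h * M * (2 + v) + h * D * v + 2 * (2 * (h * F))      ≡⟨ regroup h M D v F ⟩
      h * M * (2 + v) + h * D * v + 2 * (h * (2 * F))      ≡⟨ cong (λ m → h * M * (2 + v) + h * D * v + 2 * (h * m)) eq ⟨
      h * M * (2 + v) + h * D * v + 2 * (h * (M + D))      ≡⟨ regroup′ h M D v ⟩
      2 * (h * M) + h * (M + D) * (2 + v)                  ≡⟨ cong (λ m → 2 * (h * M) + h * m * (2 + v)) eq ⟩
      2 * (h * M) + h * (2 * F) * (2 + v)                  ≡⟨ collect h M F v ⟩
      2 * (h * M + h * F * (2 + v))                        ∎
      where
      regroup : ∀ h M D v F → h * M * (2 + v) + h * D * v + 2 * (2 * (h * F)) ≡
        h * M * (2 + v) + h * D * v + 2 * (h * (2 * F))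
      regroup = solve-∀
      regroup′ : ∀ h M D v → h * M * (2 + v) + h * D * v + 2 * (h * (M + D)) ≡
        2 * (h * M) + h * (M + D) * (2 + v)
      regroup′ = solve-∀
      collect : ∀ h M F v → 2 * (h * M) + h * (2 * F) * (2 + v) ≡ 2 * (h * M + h * F * (2 + v))
      collect = solve-∀
    halve : ∀ h → n ≡ h * M a * w → ∀ v → 2 + v ≡ w → n ≤ 2 * size a t
    halve h n≡h v w≡ = +-cancelʳ-≤ (2 * (2 * (h * F a))) n (2 * size a t) (begin
      n + 2 * (2 * (h * F a))                         ≡⟨ cong (_+ 2 * (2 * (h * F a))) n≡h ⟩
      h * M a * w + 2 * (2 * (h * F a))               ≤⟨ +-monoˡ-≤ (2 * (2 * (h * F a))) (m≤m+n (h * M a * w) (h * D * v)) ⟩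
      h * M a * w + h * D * v + 2 * (2 * (h * F a))   ≡⟨ arith h (M a) (F a) D v w (m+[n∸m]≡n M≤2F) w≡ ⟩
      2 * (h * M a + h * F a * w)                     ≡⟨ cong (2 *_) (size-formula a t h 1≤a a≤r n≡h) ⟨
      2 * (size a t + 2 * (h * F a))                  ≡⟨ *-distribˡ-+ 2 (size a t) (2 * (h * F a)) ⟩
      2 * size a t + 2 * (2 * (h * F a))              ∎)

  -- Comparison of sizes for two primes

  module Comparison (a b : ℕ) (1≤a : 1 ≤ a) (a<b : a < b) (b≤r : b ≤ r) where

    private
      a≤r = ≤-trans (<⇒≤ a<b) b≤r
      1≤b = ≤-trans 1≤a (<⇒≤ a<b)
      b≢a = >⇒≢ a<b
      P = p a
      Q = p b
      P′ = pred P
      Q′ = pred Q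
      -- With these, `M a` is `Q * R`, `M b` is `P * R`, `F a` is `Q′ * T` and `F b` is `P′ * T`.
      R = prod (sel (except₂? a b) p) r
      T = prod (sel (except₂? a b) (pred ∘ p)) r

      P≡ : suc P′ ≡ P
      P≡ = suc-pred-p a 1≤a a≤r

      Q≡ : suc Q′ ≡ Q
      Q≡ = suc-pred-p b 1≤b b≤r

      P<Q : P < Q
      P<Q = increasing a b 1≤a a<b b≤r

      split-a : ∀ f → prod (sel (except? a) f) r ≡ f b * prod (sel (except₂? a b) f) r
      split-a f = prod-except₂ f a b r b≢a 1≤b b≤r

      split-b : ∀ f → prod (sel (except? b) f) r ≡ f a * prod (sel (except₂? a b) f) r
      split-b f = prod-extract (except? b) (except₂? a b) f a r 1≤a a≤r (≢-sym b≢a)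
        (λ h → proj₁ h refl) (λ _ i≢a i≢b → i≢a , i≢b) (λ _ → proj₂)

      T≥1 : 1 ≤ T
      T≥1 = prod-positive r (sel-positive (except₂? a b) r λ i 1≤i i≤r → pred-mono-≤ (p≥2 i 1≤i i≤r))

      T≤R : T ≤ R
      T≤R = prod-mono r λ i _ _ → sel-≤ i
        where
        sel-≤ : ∀ i → sel (except₂? a b) (pred ∘ p) i ≤ sel (except₂? a b) p i
        sel-≤ i with except₂? a b i
        ... | yes _ = pred[n]≤n
        ... | no _  = ≤-refl

      -- At most `r - 2` indices are selected, so `prod-≤-selected` gives `R ≤ (r - 1) * T`.
      R≤ : R + T ≤ r * T
      R≤ = begin
        R + T                                          ≤⟨ +-monoˡ-≤ T (prod-≤-selected (except₂? a b) p r p>index) ⟩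
        suc (selected (except₂? a b) r) * T + T        ≡⟨ +-comm _ T ⟩
        (2 + selected (except₂? a b) r) * T            ≤⟨ *-monoˡ-≤ T (selected-<₂ (except₂? a b) a b r 1≤a a<b b≤r
                                                            (λ h → proj₁ h refl) (λ h → proj₂ h refl)) ⟩
        r * T                                          ∎
        where open ≤-Reasoning

      R≥1 : 1 ≤ R
      R≥1 = ≤-trans T≥1 T≤R

    -- Both sides are `n / (R * Q)`.
    cofactors : ∀ t s hₐ h_b → n ≡ hₐ * M a * P ^ t → n ≡ h_b * M b * Q ^ suc s → hₐ * P ^ t ≡ h_b * P * Q ^ s
    cofactors t s hₐ h_b n≡a n≡b = *-cancelˡ-≡ _ _ (R * Q)
      {{m*n≢0 R Q {{>-nonZero R≥1}} {{prime⇒nonZero (prime b 1≤b b≤r)}}}} (begin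
      R * Q * (hₐ * P ^ t)         ≡⟨ shuffle R Q hₐ (P ^ t) ⟩
      hₐ * (Q * R) * P ^ t         ≡⟨ cong (λ m → hₐ * m * P ^ t) (split-a p) ⟨
      hₐ * M a * P ^ t             ≡⟨ trans (sym n≡a) n≡b ⟩
      h_b * M b * (Q * Q ^ s)      ≡⟨ cong (λ m → h_b * m * (Q * Q ^ s)) (split-b p) ⟩
      h_b * (P * R) * (Q * Q ^ s)  ≡⟨ shuffle′ R Q h_b P (Q ^ s) ⟩
      R * Q * (h_b * P * Q ^ s)    ∎)
      where
      open ≡-Reasoning
      shuffle : ∀ R Q h P → R * Q * (h * P) ≡ h * (Q * R) * P
      shuffle = solve-∀
      shuffle′ : ∀ R Q h P W → h * (P * R) * (Q * W) ≡ R * Q * (h * P * W)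
      shuffle′ = solve-∀

    -- Comparing the main terms F_a p_a^t h_a and F_b p_b^(s+1) h_b of the two
    -- sizes: since p_a (p_b - 1) - (p_a - 1) p_b = p_b - p_a, a gap of h_b T p_b^s (p_b - p_a)
    -- has to be compensated by the lower order term M_b - 2 F_b of the second.
    gap-bound : ∀ t s δ → t ≤ e a → suc s ≤ e b → 2 * F a < M a → Q ≡ P + δ →
      size a t ≤ size b (suc s) → Q ^ s * δ + 3 * P < r * P + 2
    gap-bound t s δ t≤e s<e 2F<M Q≡P+δ le =
      let hₐ , hₐ≥1 , n≡a = scale a t 1≤a a≤r t≤e
          h_b , _ , n≡b = scale b (suc s) 1≤b b≤r s<e
          d , M≡ = <⇒excess 2F<M
      in finish (*-cancelˡ-< h_b _ _ (main hₐ hₐ≥1 n≡a h_b n≡b d M≡))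
      where
      open ≤-Reasoning
      W = Q ^ s
      Q′≡ : Q′ ≡ P′ + δ
      Q′≡ = suc-injective (trans Q≡ (trans Q≡P+δ (cong (_+ δ) (sym P≡))))
      main : ∀ hₐ → 1 ≤ hₐ → n ≡ hₐ * M a * P ^ t → ∀ h_b → n ≡ h_b * M b * Q ^ suc s →
        ∀ d → M a ≡ 2 * F a + suc d →
        h_b * (P * W * (Q′ * T) + 2 * (P′ * T)) < h_b * (P * R + P′ * T * (Q * W))
      main hₐ hₐ≥1 n≡a h_b n≡b d M≡ = begin-strict
        h_b * (P * W * (Q′ * T) + 2 * (P′ * T))          ≡⟨ expand h_b P W (Q′ * T) (P′ * T) ⟩
        h_b * P * W * (Q′ * T) + 2 * (h_b * (P′ * T))    ≡⟨ cong₂ (λ x y → x * (Q′ * T) + 2 * (h_b * y)) (sym (cofactors t s hₐ h_b n≡a n≡b)) (sym (split-b (pred ∘ p))) ⟩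
        hₐ * P ^ t * (Q′ * T) + 2 * (h_b * F b)          ≡⟨ cong (λ x → hₐ * P ^ t * x + 2 * (h_b * F b)) (sym (split-a (pred ∘ p))) ⟩
        -- Strictness comes from the positive summand `hₐ * suc d` of `size a t`.
        hₐ * P ^ t * F a + 2 * (h_b * F b)               <⟨ +-monoˡ-< (2 * (h_b * F b)) (m<n+m (hₐ * P ^ t * F a) {hₐ * suc d} (*-mono-≤ hₐ≥1 (s≤s z≤n))) ⟩
        hₐ * suc d + hₐ * P ^ t * F a + 2 * (h_b * F b)  ≡⟨ cong (_+ 2 * (h_b * F b)) (trans (swap hₐ (suc d) (P ^ t) (F a)) (sym (size-excess a t hₐ (suc d) 1≤a a≤r n≡a M≡))) ⟩
        size a t + 2 * (h_b * F b)                       ≤⟨ +-monoˡ-≤ (2 * (h_b * F b)) le ⟩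
        size b (suc s) + 2 * (h_b * F b)                 ≡⟨ size-formula b (suc s) h_b 1≤b b≤r n≡b ⟩
        h_b * M b + h_b * F b * (Q * W)                  ≡⟨ cong₂ (λ x y → h_b * x + h_b * y * (Q * W)) (split-b p) (split-b (pred ∘ p)) ⟩
        h_b * (P * R) + h_b * (P′ * T) * (Q * W)         ≡⟨ collect h_b (P * R) (P′ * T) (Q * W) ⟩
        h_b * (P * R + P′ * T * (Q * W))                 ∎
        where
        expand : ∀ h P W x y → h * (P * W * x + 2 * y) ≡ h * P * W * x + 2 * (h * y)
        expand = solve-∀
        swap : ∀ h d P F → h * d + h * P * F ≡ h * d + h * F * P
        swap = solve-∀
        collect : ∀ h x y w → h * x + h * y * w ≡ h * (x + y * w)
        collect = solve-∀
      identity : ∀ P′ Q′ δ W T → Q′ ≡ P′ + δ →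
        suc P′ * W * (Q′ * T) + 2 * (P′ * T) ≡ T * (W * δ + 2 * P′) + P′ * T * (suc Q′ * W)
      identity P′ _ δ W T refl = solved P′ δ W T
        where
        solved : ∀ P′ δ W T → suc P′ * W * ((P′ + δ) * T) + 2 * (P′ * T) ≡
          T * (W * δ + 2 * P′) + P′ * T * (suc (P′ + δ) * W)
        solved = solve-∀
      identity′ : P * W * (Q′ * T) + 2 * (P′ * T) ≡ T * (W * δ + 2 * P′) + P′ * T * (Q * W)
      identity′ = subst₂ (λ x y → x * W * (Q′ * T) + 2 * (P′ * T) ≡ T * (W * δ + 2 * P′) + P′ * T * (y * W))
        P≡ Q≡ (identity P′ Q′ δ W T Q′≡)
      -- Adding `T * P` makes `R + T` appear, which is at most `r * T`, so that `T` cancels.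
      finish : P * W * (Q′ * T) + 2 * (P′ * T) < P * R + P′ * T * (Q * W) →
        W * δ + 3 * P < r * P + 2
      finish lt = begin-strict
        W * δ + 3 * P                    ≡⟨ cong (λ x → W * δ + 3 * x) P≡ ⟨
        W * δ + 3 * suc P′               ≡⟨ shift (W * δ) P′ ⟩
        W * δ + 2 * P′ + suc P′ + 2      ≡⟨ cong (λ x → W * δ + 2 * P′ + x + 2) P≡ ⟩
        W * δ + 2 * P′ + P + 2           <⟨ +-monoˡ-< 2 (*-cancelˡ-< T _ _ scaled) ⟩
        r * P + 2                        ∎
        where
        shift : ∀ x P′ → x + 3 * suc P′ ≡ x + 2 * P′ + suc P′ + 2
        shift = solve-∀
        reduced : T * (W * δ + 2 * P′) < P * R
        reduced = +-cancelʳ-< (P′ * T * (Q * W)) _ _ (subst (_< P * R + P′ * T * (Q * W)) identity′ lt)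
        scaled : T * (W * δ + 2 * P′ + P) < T * (r * P)
        scaled = begin-strict
          T * (W * δ + 2 * P′ + P)       ≡⟨ *-distribˡ-+ T (W * δ + 2 * P′) P ⟩
          T * (W * δ + 2 * P′) + T * P   <⟨ +-monoˡ-< (T * P) reduced ⟩
          P * R + T * P                  ≡⟨ factor P R T ⟩
          P * (R + T)                    ≤⟨ *-monoʳ-≤ P R≤ ⟩
          P * (r * T)                    ≡⟨ swap P r T ⟩
          T * (r * P)                    ∎
          where
          factor : ∀ P R T → P * R + T * P ≡ P * (R + T)
          factor = solve-∀
          swap : ∀ P r T → P * (r * T) ≡ T * (r * P)
          swap = solve-∀

    -- Since `hₐ * P = h * Q`, multiplying both sizes by `P` expresses them through `h` alone. The
    -- difference is then `h * (Q - P) * (ρ * (P + Q) + T * (P′ * Q′ + 1))` with `ρ = R - T`.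
    size₂-decreasing : 2 ≤ e a → 2 ≤ e b → size b 2 < size a 2
    size₂-decreasing 2≤eₐ 2≤e_b =
      let hₐ , _ , n≡a = scale a 2 1≤a a≤r 2≤eₐ
          h_b , h_b≥1 , n≡b = scale b 2 1≤b b≤r 2≤e_b
          d , Q≡P+d = <⇒excess P<Q
          ρ , R≡ = m≤n⇒∃[o]m+o≡n T≤R
      in *-cancelˡ-< P _ _ (main hₐ n≡a h_b h_b≥1 n≡b d Q≡P+d ρ R≡)
      where
      open ≤-Reasoning
      identity : ∀ h P′ d T ρ → let P = suc P′; Q = P + suc d; Q′ = P′ + suc d in
        h * Q * (Q * (T + ρ)) + h * Q * (Q′ * T) * (P * (P * 1)) + 2 * (P * (h * (P′ * T)))
        ≡ P * (h * (P * (T + ρ)) + h * (P′ * T) * (Q * (Q * 1)))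
          + h * suc d * (ρ * (P + Q) + T * suc (P′ * Q′)) + 2 * (h * Q * (Q′ * T))
      identity = solve-∀
      main : ∀ hₐ → n ≡ hₐ * M a * P ^ 2 → ∀ h_b → 1 ≤ h_b → n ≡ h_b * M b * Q ^ 2 →
        ∀ d → Q ≡ P + suc d → ∀ ρ → T + ρ ≡ R → P * size b 2 < P * size a 2
      main hₐ n≡a h h≥1 n≡b d Q≡P+d ρ R≡ = +-cancelʳ-< (2 * (P * (h * F b)) + 2 * (h * Q * F a)) _ _ (begin-strict
        P * size b 2 + (2 * (P * (h * F b)) + 2 * (h * Q * F a))   ≡⟨ regroup P (size b 2) (h * F b) (2 * (h * Q * F a)) ⟩
        P * (size b 2 + 2 * (h * F b)) + 2 * (h * Q * F a)         ≡⟨ cong (λ m → P * m + 2 * (h * Q * F a)) (size-formula b 2 h 1≤b b≤r n≡b) ⟩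
        P * (h * M b + h * F b * Q ^ 2) + 2 * (h * Q * F a)        <⟨ +-monoˡ-< (2 * (h * Q * F a)) (m<m+n (P * (h * M b + h * F b * Q ^ 2)) {E} gain) ⟩
        P * (h * M b + h * F b * Q ^ 2) + E + 2 * (h * Q * F a)    ≡⟨ identity′ ⟨
        h * Q * M a + h * Q * F a * P ^ 2 + 2 * (P * (h * F b))    ≡⟨ cong (λ m → m * M a + m * F a * P ^ 2 + 2 * (P * (h * F b))) hP≡ ⟨
        hₐ * P * M a + hₐ * P * F a * P ^ 2 + 2 * (P * (h * F b))  ≡⟨ regroup₁ hₐ P (M a) (F a) (P ^ 2) (2 * (P * (h * F b))) ⟩
        P * (hₐ * M a + hₐ * F a * P ^ 2) + 2 * (P * (h * F b))    ≡⟨ cong (λ m → P * m + 2 * (P * (h * F b))) (size-formula a 2 hₐ 1≤a a≤r n≡a) ⟨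
        P * (size a 2 + 2 * (hₐ * F a)) + 2 * (P * (h * F b))      ≡⟨ regroup₂ P (size a 2) hₐ (F a) (2 * (P * (h * F b))) ⟩
        P * size a 2 + (2 * (P * (h * F b)) + 2 * (hₐ * P * F a))  ≡⟨ cong (λ m → P * size a 2 + (2 * (P * (h * F b)) + 2 * (m * F a))) hP≡ ⟩
        P * size a 2 + (2 * (P * (h * F b)) + 2 * (h * Q * F a))   ∎)
        where
        E : ℕ
        E = h * suc d * (ρ * (P + Q) + T * suc (P′ * Q′))
        gain : 1 ≤ E
        gain = *-mono-≤ (*-mono-≤ h≥1 (s≤s z≤n)) (≤-trans (*-mono-≤ T≥1 (s≤s z≤n)) (m≤n+m _ (ρ * (P + Q))))
        regroup : ∀ P z x y → P * z + (2 * (P * x) + y) ≡ P * (z + 2 * x) + y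
        regroup = solve-∀
        regroup₁ : ∀ h P M F W y → h * P * M + h * P * F * W + y ≡ P * (h * M + h * F * W) + y
        regroup₁ = solve-∀
        regroup₂ : ∀ P z h F y → P * (z + 2 * (h * F)) + y ≡ P * z + (y + 2 * (h * P * F))
        regroup₂ = solve-∀
        hP≡ : hₐ * P ≡ h * Q
        hP≡ = *-cancelˡ-≡ (hₐ * P) (h * Q) P {{prime⇒nonZero (prime a 1≤a a≤r)}}
          (trans (shuffle P hₐ) (trans (cofactors 2 1 hₐ h n≡a n≡b) (shuffle′ h P Q)))
          where
          shuffle : ∀ P h → P * (h * P) ≡ h * (P * (P * 1))
          shuffle = solve-∀
          shuffle′ : ∀ h P Q → h * P * (Q * 1) ≡ P * (h * Q)
          shuffle′ = solve-∀
        specialise : ∀ P Q Q′ R Mₐ M_b Fₐ F_b → P ≡ suc P′ → Q ≡ P + suc d → Q′ ≡ P′ + suc d → R ≡ T + ρ →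
          Mₐ ≡ Q * R → M_b ≡ P * R → Fₐ ≡ Q′ * T → F_b ≡ P′ * T →
          h * Q * Mₐ + h * Q * Fₐ * (P * (P * 1)) + 2 * (P * (h * F_b))
          ≡ P * (h * M_b + h * F_b * (Q * (Q * 1))) + h * suc d * (ρ * (P + Q) + T * suc (P′ * Q′)) + 2 * (h * Q * Fₐ)
        specialise _ _ _ _ _ _ _ _ refl refl refl refl refl refl refl refl = identity h P′ d T ρ
        identity′ : h * Q * M a + h * Q * F a * P ^ 2 + 2 * (P * (h * F b)) ≡
          P * (h * M b + h * F b * Q ^ 2) + E + 2 * (h * Q * F a)
        identity′ = specialise P Q Q′ R (M a) (M b) (F a) (F b) (sym P≡) Q≡P+d
          (suc-injective (trans Q≡ (trans Q≡P+d (cong (_+ suc d) (sym P≡))))) (sym R≡)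
          (split-a p) (split-b p) (split-a (pred ∘ p)) (split-b (pred ∘ p))

  -- From the second on the primes are odd, so each step adds at least 2.
  p≥odd : ∀ i → 2 + i ≤ r → 3 + 2 * i ≤ p (2 + i)
  p≥odd zero    h = p>index 2 (s≤s z≤n) h
  p≥odd (suc i) h = begin
    3 + 2 * suc i         ≡⟨ cong (3 +_) (*-suc 2 i) ⟩
    2 + (3 + 2 * i)       ≤⟨ +-monoʳ-≤ 2 (p≥odd i (<⇒≤ h)) ⟩
    2 + p (2 + i)         ≤⟨ prime-gap (prime (2 + i) (s≤s z≤n) (<⇒≤ h)) (prime (3 + i) (s≤s z≤n) h)
                               (≤-trans (m≤m+n 4 i) (p>index (3 + i) (s≤s z≤n) h))
                               (increasing (2 + i) (3 + i) (s≤s z≤n) ≤-refl h) ⟩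
    p (3 + i)             ∎
    where open ≤-Reasoning

  -- The right side is at most `(Q + 3) * P + Q`, which is `Q * (P + 1) + 3 * P`, and `P + 1 ≤ Q`.
  cubic-gap-absurd : ∀ P Q δ → P < Q → Q ≡ P + δ → r ≤ Q + 3 → 2 ≤ Q → ¬ Q ^ 2 * δ + 3 * P < r * P + 2
  cubic-gap-absurd P Q δ P<Q Q≡ r≤ 2≤Q lt = <⇒≱ lt (begin
    r * P + 2               ≤⟨ +-mono-≤ (*-monoˡ-≤ P r≤) 2≤Q ⟩
    (Q + 3) * P + Q         ≡⟨ shuffle P Q ⟩
    Q * suc P + 3 * P       ≤⟨ +-monoˡ-≤ (3 * P) (*-monoʳ-≤ Q (≤-trans P<Q (≤-reflexive (sym (*-identityʳ Q))))) ⟩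
    Q ^ 2 + 3 * P           ≤⟨ +-monoˡ-≤ (3 * P) (m≤m*n (Q ^ 2) δ {{>-nonZero δ≥1}}) ⟩
    Q ^ 2 * δ + 3 * P       ∎)
    where
    open ≤-Reasoning
    shuffle : ∀ P Q → (Q + 3) * P + Q ≡ Q * suc P + 3 * P
    shuffle = solve-∀
    δ≥1 : 1 ≤ δ
    δ≥1 = +-cancelˡ-< P 0 δ (subst₂ _<_ (sym (+-identityʳ P)) Q≡ P<Q)

  -- Indices and exponents that can attain the least size

  module Classification (4≤r : 4 ≤ r) (2≤e : 2 ≤ e r) (2F<M : 2 * F r < M r)
    (a t : ℕ) (1≤a : 1 ≤ a) (a≤r : a ≤ r) (2≤t : 2 ≤ t) (t≤e : t ≤ e a)
    (minimal : ∀ c u → 1 ≤ c → c ≤ r → 1 ≤ u → u ≤ e c → size a t ≤ size c u) where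

    private
      1≤r = ≤-trans (s≤s z≤n) 4≤r

    saturated : 2 * F a < M a → t ≡ e a
    saturated 2F<Mₐ with t ≟ e a
    ... | yes t≡e = t≡e
    ... | no t≢e  = contradiction
      (minimal a (e a) 1≤a a≤r (≤-trans (≤-trans (s≤s z≤n) 2≤t) t≤e) ≤-refl)
      (<⇒≱ (size-decreasing a t (e a) 1≤a a≤r (≤∧≢⇒< t≤e t≢e) ≤-refl 2F<Mₐ))

    module _ (a<r : a < r) where

      private
        δ = p r ∸ p a
        p<q : p a < p r
        p<q = increasing a r 1≤a a<r ≤-refl
        q≡ : p r ≡ p a + δ
        q≡ = sym (m+[n∸m]≡n (<⇒≤ p<q))
        p≥4 : 4 ≤ p r
        p≥4 = ≤-trans 4≤r (<⇒≤ (p>index r 1≤r ≤-refl))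

      -- Otherwise `size a t` is at least `n / 2`, while `size r 2` is below `n / 2`.
      2F<Mₐ : 2 * F a < M a
      2F<Mₐ with 2 * F a <? M a
      ... | yes lt = lt
      ... | no nlt =
        let h , h≥1 , n≡h = scale r 2 1≤r ≤-refl 2≤e
        in contradiction (≤-trans (size-above-half a t 1≤a a≤r (<⇒≤ 2≤t) t≤e (≮⇒≥ nlt))
             (*-monoʳ-≤ 2 (minimal r 2 1≤r ≤-refl (s≤s z≤n) 2≤e)))
             (<⇒≱ (size-below-half h h≥1 n≡h 1≤r 2≤e 2F<M))

      -- If `e a` were 2, then also `t = 2`, and `size r 2` would be smaller.
      3≤e : 3 ≤ e a
      3≤e with e a ≟ 2
      ... | no e≢2  = ≤∧≢⇒< (≤-trans 2≤t t≤e) (≢-sym e≢2)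
      ... | yes e≡2 = contradiction
        (subst (λ u → size a u ≤ size r 2) (≤-antisym (subst (t ≤_) e≡2 t≤e) 2≤t) (minimal r 2 1≤r ≤-refl (s≤s z≤n) 2≤e))
        (<⇒≱ (Comparison.size₂-decreasing a r 1≤a a<r ≤-refl (subst (2 ≤_) (sym e≡2) ≤-refl) 2≤e))

      -- If `e r ≥ 3`, the comparison with `size r 3` gives the bound refuted by `cubic-gap-absurd`.
      e≡2 : e r ≡ 2
      e≡2 with e r ≟ 2
      ... | yes eq = eq
      ... | no e≢2 = contradiction
        (Comparison.gap-bound a r 1≤a a<r ≤-refl t 2 δ t≤e 3≤er 2F<Mₐ q≡ (minimal r 3 1≤r ≤-refl (s≤s z≤n) 3≤er))
        (cubic-gap-absurd (p a) (p r) δ p<q q≡ (m≤n⇒m≤n+o 3 (<⇒≤ (p>index r 1≤r ≤-refl))) (p≥2 r 1≤r ≤-refl))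
        where
        3≤er : 3 ≤ e r
        3≤er = ≤∧≢⇒< 2≤e (≢-sym e≢2)

      -- If `r ≤ 3 + δ`, then `r * p a + 2` is at most `(3 + δ) * p a + δ * δ`, the 2 being absorbed
      -- because `δ ≥ 2` by `prime-gap`. This equals `p r * δ + 3 * p a`, against `gap-bound`.
      small-gap : δ ≤ r ∸ 4
      small-gap with δ ≤? r ∸ 4
      ... | yes le = le
      ... | no nle = contradiction
        (subst (λ m → m * δ + 3 * p a < r * p a + 2) (*-identityʳ (p r))
          (Comparison.gap-bound a r 1≤a a<r ≤-refl t 1 δ t≤e 2≤e 2F<Mₐ q≡ (minimal r 2 1≤r ≤-refl (s≤s z≤n) 2≤e)))
        (≤⇒≯ (begin
          r * p a + 2                     ≤⟨ +-mono-≤ (*-monoˡ-≤ (p a) r≤) (≤-trans 2≤δ (m≤m*n δ δ {{>-nonZero (<⇒≤ 2≤δ)}})) ⟩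
          (3 + δ) * p a + δ * δ           ≡⟨ shuffle (p a) δ ⟩
          (p a + δ) * δ + 3 * p a         ≡⟨ cong (λ m → m * δ + 3 * p a) q≡ ⟨
          p r * δ + 3 * p a               ∎))
        where
        open ≤-Reasoning
        shuffle : ∀ P δ → (3 + δ) * P + δ * δ ≡ (P + δ) * δ + 3 * P
        shuffle = solve-∀
        r≤ : r ≤ 3 + δ
        r≤ = subst (_≤ 3 + δ) (m+[n∸m]≡n 4≤r) (+-monoʳ-≤ 3 (≰⇒> nle))
        2≤δ : 2 ≤ δ
        2≤δ = +-cancelˡ-≤ (p a) 2 δ (subst₂ _≤_ (+-comm 2 (p a)) q≡
          (prime-gap (prime a 1≤a a≤r) (prime r 1≤r ≤-refl) p≥4 p<q))

      -- Since `p r ≥ 2 * r - 1`, a gap of at most `r - 4` keeps `p b` above `r`, so the comparison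
      -- with `size b 3` falls under `cubic-gap-absurd`.
      largest : ∀ b → a < b → b < r → 3 ≤ e b → p r ∸ p b ≤ r ∸ 4 → ⊥
      largest b a<b b<r 3≤e_b gap = cubic-gap-absurd (p a) (p b) (p b ∸ p a) pₐ<p_b p_b≡ r≤ (p≥2 b 1≤b (<⇒≤ b<r))
        (Comparison.gap-bound a b 1≤a a<b (<⇒≤ b<r) t 2 (p b ∸ p a) t≤e 3≤e_b 2F<Mₐ p_b≡
          (minimal b 3 1≤b (<⇒≤ b<r) (s≤s z≤n) 3≤e_b))
        where
        open ≤-Reasoning
        1≤b = ≤-trans 1≤a (<⇒≤ a<b)
        pₐ<p_b : p a < p b
        pₐ<p_b = increasing a b 1≤a a<b (<⇒≤ b<r)
        p_b≡ : p b ≡ p a + (p b ∸ p a)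
        p_b≡ = sym (m+[n∸m]≡n (<⇒≤ pₐ<p_b))
        k = r ∸ 4
        r≡ : 4 + k ≡ r
        r≡ = m+[n∸m]≡n 4≤r
        odd : 3 + 2 * (2 + k) ≤ p r
        odd = subst (λ m → 3 + 2 * (2 + k) ≤ p m) r≡ (p≥odd (2 + k) (≤-reflexive r≡))
        shuffle : ∀ k → 4 + k + k + 3 ≡ 3 + 2 * (2 + k)
        shuffle = solve-∀
        r≤ : r ≤ p b + 3
        r≤ = +-cancelʳ-≤ k r (p b + 3) (begin
          r + k                 ≡⟨ cong (_+ k) r≡ ⟨
          4 + k + k             ≤⟨ m≤m+n _ 3 ⟩
          4 + k + k + 3         ≡⟨ shuffle k ⟩
          3 + 2 * (2 + k)       ≤⟨ odd ⟩
          p r                   ≡⟨ m+[n∸m]≡n (<⇒≤ (increasing b r 1≤b b<r ≤-refl)) ⟨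
          p b + (p r ∸ p b)     ≤⟨ +-monoʳ-≤ (p b) gap ⟩
          p b + k               ≤⟨ +-monoˡ-≤ k (m≤m+n (p b) 3) ⟩
          p b + 3 + k           ∎)

  -- The sets Z as cut-sets

  member-of-all : ∀ {X : Subset n} {P : ℕ → Set} → (∀ (x : Fin n) → P (toℕ x) → x ∈ X) →
    ∀ x → x < n → P x → Member X x
  member-of-all {X} {P} h x x<n Px = subst (Member X) (toℕ-fromℕ< x<n)
    (∈⇒Member (h (fromℕ< x<n) (subst P (sym (toℕ-fromℕ< x<n)) Px)))

  zSubset : ℕ → ℕ → Subset n
  zSubset a s = tabulate λ x → does (zSet? a s (toℕ x))

  ∈zSubset⇒ : ∀ a s (x : Fin n) → x ∈ zSubset a s → ZSet a s (toℕ x)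
  ∈zSubset⇒ a s x x∈ = toWitness′ (zSet? a s (toℕ x))
    (trans (sym (lookup∘tabulate (λ y → does (zSet? a s (toℕ y))) x)) ([]=⇒lookup x∈))

  ⇒∈zSubset : ∀ a s (x : Fin n) → ZSet a s (toℕ x) → x ∈ zSubset a s
  ⇒∈zSubset a s x z = lookup⇒[]= x (zSubset a s)
    (trans (lookup∘tabulate (λ y → does (zSet? a s (toℕ y))) x) (dec-true (zSet? a s (toℕ x)) z))

  card-zSet : ∀ a s (X : Subset n) → X ≐ (λ x → ZSet a s (toℕ x)) → ∣ X ∣ ≡ size a s
  card-zSet a s X X≐ = trans (card≡count X) (count-cong (member? X) (zSet? a s) n
    (λ x x<n m → subst (ZSet a s) (toℕ-fromℕ< x<n)
      (proj₁ (X≐ (fromℕ< x<n)) (Member⇒∈ (subst (Member X) (sym (toℕ-fromℕ< x<n)) m))))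
    (member-of-all λ x → proj₂ (X≐ x)))

  another : 2 ≤ r → ∀ a → ∃ λ i → 1 ≤ i × i ≤ r × i ≢ a
  another 2≤r a with a ≟ 1
  ... | yes refl = 2 , s≤s z≤n , 2≤r , λ ()
  ... | no a≢1   = 1 , ≤-refl , <⇒≤ 2≤r , ≢-sym a≢1

  -- Outside `Z`, an element is divisible by `P` exactly when no `p j` with `j` different from `a`
  -- divides it. Divisibility by `P` and by `p j` both pass to powers, so no edge outside `Z` leaves
  -- the multiples of `P`. This separates `p a ^ s` from `p i`.
  zSubset-cut : 2 ≤ r → ∀ a s → 1 ≤ a → a ≤ r → 1 ≤ s → s ≤ e a → IsCutSet (PowerAdj n) (zSubset a s)
  zSubset-cut 2≤r a s 1≤a a≤r 1≤s s≤e with another 2≤r a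
  ... | i , 1≤i , i≤r , i≢a = u , v , u∉ , v∉ , λ reach → ¬P∣v (proj₂ (reachable reach))
    where
    P = p a ^ s
    Z = zSubset a s
    iP≤n : p i * P ≤ n
    iP≤n = ∣⇒≤ {{>-nonZero n≥1}} (pp^∣n i a s 1≤i i≤r 1≤a a≤r i≢a s≤e)
    P≥1 : 1 ≤ P
    P≥1 = m^n>0 (p a) {{prime⇒nonZero (prime a 1≤a a≤r)}} s
    P≥2 : 2 ≤ P
    P≥2 = ≤-trans (p≥2 a 1≤a a≤r) (subst (_≤ P) (^-identityʳ (p a))
      (^-monoʳ-≤ (p a) {{prime⇒nonZero (prime a 1≤a a≤r)}} 1≤s))
    u<n : P < n
    u<n = ≤-trans (subst (_< p i * P) (*-identityˡ P) (*-monoˡ-< P {{>-nonZero P≥1}} (p≥2 i 1≤i i≤r))) iP≤n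
    v<n : p i < n
    v<n = ≤-trans (subst (_< p i * P) (*-identityʳ (p i)) (*-monoʳ-< (p i) {{prime⇒nonZero (prime i 1≤i i≤r)}} P≥2)) iP≤n
    u v : Fin n
    u = fromℕ< u<n
    v = fromℕ< v<n
    P∣u : P ∣ toℕ u
    P∣u = subst (P ∣_) (sym (toℕ-fromℕ< u<n)) ∣-refl
    ¬P∣v : ¬ P ∣ toℕ v
    ¬P∣v d = i≢a (distinct i a 1≤i i≤r 1≤a a≤r (sym (prime-∣-prime (prime a 1≤a a≤r) (prime i 1≤i i≤r)
      (∣-trans (subst (_∣ P) (^-identityʳ (p a)) (^-∣ (p a) 1≤s)) (subst (P ∣_) (toℕ-fromℕ< v<n) d)))))
    ¬ZSet-u : ¬ ZSet a s (toℕ u)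
    ¬ZSet-u (inj₁ (_ , ¬d)) = ¬d P∣u
    ¬ZSet-u (inj₂ ((j , j≤r , 1≤j , j≢a , d) , _)) =
      p∤p^ j a s 1≤j (s≤s⁻¹ j≤r) 1≤a a≤r j≢a (subst (p j ∣_) (toℕ-fromℕ< u<n) d)
    ¬ZSet-v : ¬ ZSet a s (toℕ v)
    ¬ZSet-v (inj₁ (miss , _)) = miss (i , s≤s i≤r , 1≤i , i≢a , subst (p i ∣_) (sym (toℕ-fromℕ< v<n)) ∣-refl)
    ¬ZSet-v (inj₂ (_ , d))    = ¬P∣v d
    u∉ : u ∉ Z
    u∉ = ¬ZSet-u ∘ ∈zSubset⇒ a s u
    v∉ : v ∉ Z
    v∉ = ¬ZSet-v ∘ ∈zSubset⇒ a s v
    reachable : ∀ {w} → Reach (PowerAdj n) Z u w → w ∉ Z × P ∣ toℕ w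
    reachable (here u∉Z) = u∉Z , P∣u
    reachable (step {x} {w} reach (_ , power) w∉Z) with reachable reach | P ∣? toℕ w
    ... | _          | yes d = w∉Z , d
    ... | x∉Z , P∣x  | no ¬d = ⊥-elim (case power of λ where
      (inj₁ w-power) → ¬d (power⇒∣ x w w-power (p^∣n a s 1≤a a≤r s≤e) P∣x)
      (inj₂ x-power) → w∉Z (⇒∈zSubset a s w (inj₁ ((λ (j , j≤r , 1≤j , j≢a , d) →
        x∉Z (⇒∈zSubset a s x (inj₂ ((j , j≤r , 1≤j , j≢a ,
          power⇒∣ w x x-power (p∣n j 1≤j (s≤s⁻¹ j≤r)) d) , P∣x)))) , ¬d))))

  -- Structure of a separating set of least size

  module Separation (4≤r : 4 ≤ r) (2≤e : 2 ≤ e r) (2F<M : 2 * F r < M r)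
    (X : Subset n) (small : ∀ a s → 1 ≤ a → a ≤ r → 1 ≤ s → s ≤ e a → count (member? X) n ≤ size a s)
    (S : Fin n → Set) (S? : ∀ x → Dec (S x)) (u v : Fin n) (u∉X : u ∉ X) (v∉X : v ∉ X) (Su : S u) (¬Sv : ¬ S v)
    (same : ∀ x y → x ∉ X → y ∉ X → IsPowerOf y x → (S x → S y) × (S y → S x)) where

    private
      1≤r = ≤-trans (s≤s z≤n) 4≤r

    -- Every element is a power of a generator, so a generator outside `X` would put `u` and `v` on
    -- the same side.
    not-in-both : ∀ {x} → x ∉ X → ¬ gcd (toℕ x) n ≡ 1
    not-in-both {x} x∉X g≡1 = ¬Sv (proj₁ (same x v x∉X v∉X (dominates v))
      (proj₂ (same x u x∉X u∉X (dominates u)) Su))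
      where
      dominates : ∀ y → IsPowerOf y x
      dominates y = gcd∣⇒power x y (subst (_∣ toℕ y) (sym g≡1) (1∣ toℕ y))

    unit⊆X : ∀ x → gcd (toℕ x) n ≡ 1 → x ∈ X
    unit⊆X x g≡1 = decidable-stable (x ∈? X) λ x∉X → not-in-both x∉X g≡1

    unit⊆X′ : ∀ x → x < n → gcd x n ≡ 1 → Member X x
    unit⊆X′ = member-of-all {P = λ x → gcd x n ≡ 1} unit⊆X

    -- Generators and elements of `P` are disjoint parts of `X`, whose size would then exceed
    -- `size r 2`. The lower bounds above all enter through this lemma.
    contradict : ∀ {A : Set} {P : ℕ → Set} (P? : Dec₁ P) {m} → m ≤ count P? n → size r 2 < φ n + m →
      (∀ x → P (toℕ x) → x ∈ X) → (∀ x → P x → ¬ gcd x n ≡ 1) → A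
    contradict {P = P} P? {m} m≤ lt P⊆X P⇒nonunit = contradiction lt (≤⇒≯ (begin
      φ n + m                       ≤⟨ +-monoʳ-≤ (φ n) m≤ ⟩
      φ n + count P? n              ≡⟨ cong (_+ count P? n) (φ-count n) ⟩
      count unit? n + count P? n    ≤⟨ count-disjoint unit? P? (member? X) n unit⊆X′
                                         (member-of-all {P = P} P⊆X) (λ x _ g≡1 Px → P⇒nonunit x Px g≡1) ⟩
      count (member? X) n           ≤⟨ small r 2 1≤r ≤-refl (s≤s z≤n) 2≤e ⟩
      size r 2                      ∎))
      where open ≤-Reasoning

    count-⊎ : ∀ {P Q : ℕ → Set} (P? : Dec₁ P) (Q? : Dec₁ Q) → (∀ x → P x → ¬ Q x) →
      count P? n + count Q? n ≤ count (λ x → P? x ⊎-dec Q? x) n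
    count-⊎ P? Q? disjoint = count-disjoint P? Q? (λ x → P? x ⊎-dec Q? x) n
      (λ _ _ → inj₁) (λ _ _ → inj₂) (λ x _ → disjoint x)

    -- `¬ Rep i` means that the whole coatom class of `i` lies in `X`.
    Rep : ℕ → Set
    Rep i = ∃ λ x → gcd (toℕ x) n ≡ p i × x ∉ X

    rep? : Dec₁ Rep
    rep? i = Finₚ.any? λ x → (gcd (toℕ x) n ≟ p i) ×-dec ¬? (x ∈? X)

    K : ℕ → Set
    K i = ∃ λ x → gcd (toℕ x) n ≡ p i × x ∉ X × S x

    K? : Dec₁ K
    K? i = Finₚ.any? λ x → (gcd (toℕ x) n ≟ p i) ×-dec ¬? (x ∈? X) ×-dec S? x

    coatom⊆X : ∀ {i} → ¬ Rep i → ∀ x → gcd (toℕ x) n ≡ p i → x ∈ X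
    coatom⊆X ¬rep x g≡ = decidable-stable (x ∈? X) λ x∉X → ¬rep (x , g≡ , x∉X)

    -- Every multiple of `p i` is a power of each element of the coatom class, so one representative
    -- outside `X` fixes the side of all multiples outside `X`.
    K⇒S : ∀ {i x} → K i → x ∉ X → p i ∣ toℕ x → S x
    K⇒S {x = x} (w , g≡ , w∉X , Sw) x∉X d =
      proj₁ (same w x w∉X x∉X (gcd∣⇒power w x (subst (_∣ toℕ x) (sym g≡) d))) Sw

    ¬K⇒¬S : ∀ {i x} → Rep i → ¬ K i → x ∉ X → p i ∣ toℕ x → ¬ S x
    ¬K⇒¬S {x = x} (w , g≡ , w∉X) ¬Ki x∉X d Sx =
      ¬Ki (w , g≡ , w∉X , proj₂ (same w x w∉X x∉X (gcd∣⇒power w x (subst (_∣ toℕ x) (sym g≡) d))) Sx)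

    hits : ∀ {x} → x ∉ X → Hit r (λ _ → Unit) p (toℕ x)
    hits {x} x∉X = decidable-stable (hit? r (λ _ → yes tt) p (toℕ x)) λ miss → not-in-both x∉X (noHit⇒unit (toℕ x) miss)

    coatom⇒nonunit : ∀ {x i} → 1 ≤ i → i ≤ r → gcd x n ≡ p i → ¬ gcd x n ≡ 1
    coatom⇒nonunit {i = i} 1≤i i≤r g≡ g≡1 = ¬prime[1] (subst Prime (trans (sym g≡) g≡1) (prime i 1≤i i≤r))

    -- `L` will be `K` or its complement, whichever omits `r`, as `two-sided-bound` requires.
    no-two-sided : ∀ {L : ℕ → Set} (L? : Dec₁ L) i → 1 ≤ i → i ≤ r → L i → ¬ L r →
      (∀ x → Hit r L p (toℕ x) → Hit r (λ j → ¬ L j) p (toℕ x) → x ∈ X) → ⊥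
    no-two-sided L? i 1≤i i≤r Li ¬Lr ⊆X =
      let h , h≥1 , n≡h = scale r 2 1≤r ≤-refl 2≤e
      in contradict (λ x → hit? r L? p x ×-dec hit? r (λ j → ¬? (L? j)) p x) ≤-refl
        (two-sided-bound h h≥1 n≡h 1≤r 2≤e 2F<M L? i 1≤i (≤∧≢⇒< i≤r λ { refl → ¬Lr Li }) Li ¬Lr)
        (λ x (a , b) → ⊆X x a b)
        (λ x ((j , j≤r , 1≤j , _ , d) , _) g≡1 → unit⇒∤ x j 1≤j (s≤s⁻¹ j≤r) g≡1 d)

    -- If every coatom has a representative, an element divisible by primes from both sides would
    -- link the sides, so it lies in `X`. The block omitting `r` is nonempty because some prime
    -- divides `u`, respectively `v`.
    some-coatom-removed : ¬ InRange r Rep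
    some-coatom-removed reps with K? r
    ... | no ¬Kr with hits u∉X
    ...   | i , i≤r , 1≤i , _ , d = no-two-sided K? i 1≤i (s≤s⁻¹ i≤r)
      (decidable-stable (K? i) λ ¬Ki → ¬K⇒¬S (reps i 1≤i (s≤s⁻¹ i≤r)) ¬Ki u∉X d Su) ¬Kr
      λ x (j , _ , _ , Kj , d₁) (k , k≤r , 1≤k , ¬Kk , d₂) → decidable-stable (x ∈? X) λ x∉X →
        ¬K⇒¬S (reps k 1≤k (s≤s⁻¹ k≤r)) ¬Kk x∉X d₂ (K⇒S Kj x∉X d₁)
    some-coatom-removed reps | yes Kr with hits v∉X
    ...   | i , i≤r , 1≤i , _ , d = no-two-sided (λ j → ¬? (K? j)) i 1≤i (s≤s⁻¹ i≤r)
      (λ Ki → ¬Sv (K⇒S Ki v∉X d)) (λ ¬Kr → ¬Kr Kr)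
      λ x (k , k≤r , 1≤k , ¬Kk , d₂) (j , _ , _ , ¬¬Kj , d₁) → decidable-stable (x ∈? X) λ x∉X →
        ¬K⇒¬S (reps k 1≤k (s≤s⁻¹ k≤r)) ¬Kk x∉X d₂ (K⇒S (decidable-stable (K? j) ¬¬Kj) x∉X d₁)

    one-coatom-removed : ∀ i j → 1 ≤ i → i < j → j ≤ r → ¬ Rep i → ¬ Rep j → ⊥
    one-coatom-removed i j 1≤i i<j j≤r ¬rᵢ ¬rⱼ =
      let h , h≥1 , n≡h = scale r 2 1≤r ≤-refl 2≤e
      in contradict (λ x → coatom? i x ⊎-dec coatom? j x)
        (count-⊎ (coatom? i) (coatom? j) λ x g≡ᵢ g≡ⱼ →
          <⇒≢ i<j (distinct i j 1≤i i≤r 1≤j j≤r (trans (sym g≡ᵢ) g≡ⱼ)))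
        (two-coatom-bound h h≥1 n≡h 1≤r 2≤e 2F<M i j 1≤i i<j j≤r)
        (λ { x (inj₁ g≡) → coatom⊆X ¬rᵢ x g≡ ; x (inj₂ g≡) → coatom⊆X ¬rⱼ x g≡ })
        (λ { x (inj₁ g≡) → coatom⇒nonunit {x} 1≤i i≤r g≡ ; x (inj₂ g≡) → coatom⇒nonunit {x} 1≤j j≤r g≡ })
      where
      1≤j = ≤-trans 1≤i (<⇒≤ i<j)
      i≤r = ≤-trans (<⇒≤ i<j) j≤r

    one-sided : ∀ a i j → 1 ≤ a → a ≤ r → ¬ Rep a → 1 ≤ i → i < j → j ≤ r → i ≢ a →
      (∀ x → p i ∣ toℕ x → p j ∣ toℕ x → x ∈ X) → ⊥
    one-sided a i j 1≤a a≤r ¬rₐ 1≤i i<j j≤r i≢a ⊆X =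
      let h , h≥1 , n≡h = scale r 2 1≤r ≤-refl 2≤e
      in contradict (λ x → coatom? a x ⊎-dec p i * p j ∣? x)
        (count-⊎ (coatom? a) (p i * p j ∣?_) λ x g≡ d → i≢a (distinct i a 1≤i i≤r 1≤a a≤r
          (prime-∣-prime (prime i 1≤i i≤r) (prime a 1≤a a≤r)
            (subst (p i ∣_) g≡ (gcd-greatest (m*n∣⇒m∣ (p i) (p j) d) (p∣n i 1≤i i≤r))))))
        (coatom-multiples-bound h h≥1 n≡h 1≤r 2≤e 2F<M a i j 1≤a a≤r 1≤i i<j j≤r)
        (λ { x (inj₁ g≡) → coatom⊆X ¬rₐ x g≡ ; x (inj₂ d) → ⊆X x (m*n∣⇒m∣ (p i) (p j) d) (m*n∣⇒n∣ (p i) (p j) d) })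
        (λ { x (inj₁ g≡) → coatom⇒nonunit {x} 1≤a a≤r g≡ ; x (inj₂ d) g≡1 → unit⇒∤ x i 1≤i i≤r g≡1 (m*n∣⇒m∣ (p i) (p j) d) })
      where
      i≤r = ≤-trans (<⇒≤ i<j) j≤r

    IsZ : ℕ → ℕ → Set
    IsZ a t = X ≐ λ x → ZSet a t (toℕ x)

    -- The exponent `t` is the least for which `O` has an element `y` outside `X` with gcd
    -- `p a ^ t`. In the second alternative of `ZSet` elements are powers of `y`, in the first `y`
    -- is a power of them. Outside `X` they would lie in `O`, against `pure` or minimality. So the
    -- set is contained in `X`, and the size bound forces equality.
    isolated : ∀ a → 1 ≤ a → a ≤ r → ¬ Rep a →
      (O : Fin n → Set) (O? : ∀ x → Dec (O x)) → (∀ x y → x ∉ X → y ∉ X → IsPowerOf y x → (O x → O y) × (O y → O x)) →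
      (∀ x → x ∉ X → O x → ¬ Other a (toℕ x)) → ∀ w → w ∉ X → O w →
      ∃ λ t → 2 ≤ t × t ≤ e a × IsZ a t
    isolated a 1≤a a≤r ¬rₐ O O? sameO pure w w∉X Ow
      with t₀ , t₀≤e , g₀≡ ← gcd-noOther a (toℕ w) 1≤a a≤r (pure w w∉X Ow)
      with least (λ t → Finₚ.any? λ x → (gcd (toℕ x) n ≟ p a ^ t) ×-dec ¬? (x ∈? X) ×-dec O? x) t₀ (w , g₀≡ , w∉X , Ow)
    ... | t , t≤t₀ , (y , g≡ , y∉X , Oy) , minimal = t , t≥2 t g≡ , t≤e , λ x →
        (λ x∈X → count-saturated (zSet? a t) (member? X) n (member-of-all {P = ZSet a t} Z⊆X)
          (small a t 1≤a a≤r (<⇒≤ (t≥2 t g≡)) t≤e) (toℕ x) (toℕ<n x) (∈⇒Member x∈X)) , Z⊆X x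
      where
      t≤e = ≤-trans t≤t₀ t₀≤e
      -- Exponent 0 would make `y` a generator and exponent 1 a member of the coatom class of `a`,
      -- and both kinds lie in `X`.
      t≥2 : ∀ t → gcd (toℕ y) n ≡ p a ^ t → 2 ≤ t
      t≥2 zero          g≡ = contradiction g≡ (not-in-both y∉X)
      t≥2 (suc zero)    g≡ = contradiction (coatom⊆X ¬rₐ y (trans g≡ (^-identityʳ (p a)))) y∉X
      t≥2 (suc (suc t)) g≡ = s≤s (s≤s z≤n)
      Z⊆X : ∀ x → ZSet a t (toℕ x) → x ∈ X
      Z⊆X x (inj₂ (other , d)) = decidable-stable (x ∈? X) λ x∉X →
        pure x x∉X (proj₁ (sameO y x y∉X x∉X (gcd∣⇒power y x (subst (_∣ toℕ x) (sym g≡) d))) Oy) other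
      Z⊆X x (inj₁ (miss , ¬d)) with gcd-noOther a (toℕ x) 1≤a a≤r miss
      ... | t′ , _ , g′≡ = decidable-stable (x ∈? X) λ x∉X → minimal t′ t′<t
        (x , g′≡ , x∉X , proj₂ (sameO x y x∉X y∉X (gcd∣⇒power x y
          (subst (_∣ toℕ y) (sym g′≡) (∣-trans (^-∣ (p a) (<⇒≤ t′<t)) (subst (_∣ toℕ y) g≡ (gcd[m,n]∣m (toℕ y) n)))))) Oy)
        where
        t′<t : t′ < t
        t′<t = ≰⇒> λ t≤t′ → ¬d (∣-trans (^-∣ (p a) t≤t′) (subst (_∣ toℕ x) g′≡ (gcd[m,n]∣m (toℕ x) n)))

    -- The bounds on `a` and `t` are those of `anyUpTo?`, which makes the statement decidable and
    -- hence stable under double negation.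
    Shape : Set
    Shape = ∃ λ a → a < suc r × (1 ≤ a × ∃ λ t → t < suc (e a) × (2 ≤ t × IsZ a t))

    -- A side meeting no coatom except possibly that of `a` has only `p a` among its primes, and
    -- `isolated` applies. Otherwise coatoms `i` and `j` on opposite sides force all common
    -- multiples of `p i` and `p j` into `X`, which `one-sided` excludes.
    shape-at : ∀ a → 1 ≤ a → a ≤ r → ¬ Rep a → (∀ i → 1 ≤ i → i ≤ r → i ≢ a → Rep i) → Shape
    shape-at a 1≤a a≤r ¬rₐ reps = wrap (sides (anyUpTo? (λ i → 1 ≤? i ×-dec except? a i ×-dec K? i) (suc r))
                                              (anyUpTo? (λ i → 1 ≤? i ×-dec except? a i ×-dec ¬? (K? i)) (suc r)))
      where
      wrap : (∃ λ t → 2 ≤ t × t ≤ e a × IsZ a t) → Shape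
      wrap (t , 2≤t , t≤e , isZ) = a , s≤s a≤r , 1≤a , t , s≤s t≤e , 2≤t , isZ
      sides : Dec (∃ λ i → i < suc r × (1 ≤ i × i ≢ a × K i)) → Dec (∃ λ i → i < suc r × (1 ≤ i × i ≢ a × ¬ K i)) →
        ∃ λ t → 2 ≤ t × t ≤ e a × IsZ a t
      sides (no noK) _ = isolated a 1≤a a≤r ¬rₐ S S? same
        (λ x x∉X Sx (i , i≤r , 1≤i , i≢a , d) → ¬K⇒¬S (reps i 1≤i (s≤s⁻¹ i≤r) i≢a)
          (λ Ki → noK (i , i≤r , 1≤i , i≢a , Ki)) x∉X d Sx) u u∉X Su
      sides (yes _) (no no¬K) = isolated a 1≤a a≤r ¬rₐ (λ x → ¬ S x) (λ x → ¬? (S? x))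
        (λ x y x∉X y∉X power → (_∘ proj₂ (same x y x∉X y∉X power)) , (_∘ proj₁ (same x y x∉X y∉X power)))
        (λ x x∉X ¬Sx (i , i≤r , 1≤i , i≢a , d) → ¬Sx (K⇒S
          (decidable-stable (K? i) λ ¬Ki → no¬K (i , i≤r , 1≤i , i≢a , ¬Ki)) x∉X d)) v v∉X ¬Sv
      sides (yes (i , i≤r , 1≤i , i≢a , Ki)) (yes (j , j≤r , 1≤j , j≢a , ¬Kj)) = ⊥-elim (case <-cmp i j of λ where
          (tri< i<j _ _)  → one-sided a i j 1≤a a≤r ¬rₐ 1≤i i<j (s≤s⁻¹ j≤r) i≢a ⊆X
          (tri≈ _ refl _) → ¬Kj Ki
          (tri> _ _ j<i)  → one-sided a j i 1≤a a≤r ¬rₐ 1≤j j<i (s≤s⁻¹ i≤r) j≢a λ x dⱼ dᵢ → ⊆X x dᵢ dⱼ)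
        where
        ⊆X : ∀ x → p i ∣ toℕ x → p j ∣ toℕ x → x ∈ X
        ⊆X x dᵢ dⱼ = decidable-stable (x ∈? X) λ x∉X →
          ¬K⇒¬S (reps j 1≤j (s≤s⁻¹ j≤r) j≢a) ¬Kj x∉X dⱼ (K⇒S Ki x∉X dᵢ)

    shape : Shape
    shape with anyUpTo? (λ i → 1 ≤? i ×-dec ¬? (rep? i)) (suc r)
    ... | no none = ⊥-elim (some-coatom-removed λ i 1≤i i≤r →
      decidable-stable (rep? i) λ ¬rep → none (i , s≤s i≤r , 1≤i , ¬rep))
    ... | yes (a , a≤r , 1≤a , ¬rₐ) = shape-at a 1≤a (s≤s⁻¹ a≤r) ¬rₐ λ i 1≤i i≤r i≢a →
      decidable-stable (rep? i) λ ¬rᵢ → case <-cmp i a of λ where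
        (tri< i<a _ _) → one-coatom-removed i a 1≤i i<a (s≤s⁻¹ a≤r) ¬rᵢ ¬rₐ
        (tri≈ _ i≡a _) → i≢a i≡a
        (tri> _ _ a<i) → one-coatom-removed a i 1≤a a<i i≤r ¬rₐ ¬rᵢ

  -- Application to minimum cut-sets

  card-minimal : 2 ≤ r → (X : Subset n) → IsMinCutSet (PowerAdj n) X →
    ∀ a s → 1 ≤ a → a ≤ r → 1 ≤ s → s ≤ e a → ∣ X ∣ ≤ size a s
  card-minimal 2≤r X (_ , min) a s 1≤a a≤r 1≤s s≤e =
    subst (∣ X ∣ ≤_) (card-zSet a s (zSubset a s) λ x → ∈zSubset⇒ a s x , ⇒∈zSubset a s x)
      (min (zSubset a s) (zSubset-cut 2≤r a s 1≤a a≤r 1≤s s≤e))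

  -- The side `S` is reachability from `u`. It is decided under a double negation only, which
  -- suffices because the conclusion is decidable.
  min-cut-shape : 4 ≤ r → 2 ≤ e r → 2 * F r < M r → (X : Subset n) → IsMinCutSet (PowerAdj n) X →
    ∃ λ a → a < suc r × (1 ≤ a × ∃ λ t → t < suc (e a) × (2 ≤ t × X ≐ λ x → ZSet a t (toℕ x)))
  min-cut-shape 4≤r 2≤e 2F<M X minCut@((u , v , u∉X , v∉X , ¬reach) , _) =
    decidable-stable
      (anyUpTo? (λ a → 1 ≤? a ×-dec anyUpTo? (λ t → 2 ≤? t ×-dec ≐? a t) (suc (e a))) (suc r))
      λ ¬shape → ¬¬-decidable (Reach (PowerAdj n) X u) λ S? → ¬shape
        (Separation.shape 4≤r 2≤e 2F<M X small (Reach (PowerAdj n) X u) S? u v u∉X v∉X (here u∉X) ¬reach same)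
    where
    ≐? : ∀ a t → Dec (X ≐ λ x → ZSet a t (toℕ x))
    ≐? a t = Finₚ.all? λ x → ((x ∈? X) →-dec zSet? a t (toℕ x)) ×-dec (zSet? a t (toℕ x) →-dec (x ∈? X))
    small : ∀ a s → 1 ≤ a → a ≤ r → 1 ≤ s → s ≤ e a → count (member? X) n ≤ size a s
    small a s 1≤a a≤r 1≤s s≤e = subst (_≤ size a s) (card≡count X)
      (card-minimal (≤-trans (s≤s (s≤s z≤n)) 4≤r) X minCut a s 1≤a a≤r 1≤s s≤e)
    same : ∀ x y → x ∉ X → y ∉ X → IsPowerOf y x →
      (Reach (PowerAdj n) X u x → Reach (PowerAdj n) X u y) × (Reach (PowerAdj n) X u y → Reach (PowerAdj n) X u x)
    same x y x∉X y∉X power with x Finₚ.≟ y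
    ... | yes refl = id , id
    ... | no x≢y   = (λ reach → step reach (x≢y , inj₁ power) y∉X) ,
                     (λ reach → step reach (≢-sym x≢y , inj₂ power) x∉X)

  ≐-InZ : ∀ a s → 1 ≤ a → a ≤ r → s ≤ e a → (X : Subset n) → (X ≐ λ x → ZSet a s (toℕ x)) → X ≐ InZ n r p a s
  ≐-InZ a s 1≤a a≤r s≤e X X≐ x = ZSet⇒InZ a s 1≤a a≤r s≤e x ∘ proj₁ (X≐ x) , proj₂ (X≐ x) ∘ InZ⇒ZSet a s 1≤a a≤r s≤e x

  ⇒2φ< : ∀ j → 1 ≤ j → j ≤ r → 2 * F j < M j → 2 * φ (prod p r ÷ p j) < prod p r ÷ p j
  ⇒2φ< j 1≤j j≤r = subst₂ (λ x y → 2 * x < y) (sym (trans (cong φ (M≡÷ j 1≤j j≤r)) (φM≡F j))) (sym (M≡÷ j 1≤j j≤r))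

  M-last : 1 ≤ r → M r ≡ prod p (r ∸ 1)
  M-last 1≤r = prod-except-last p r 1≤r

  -- The two cases of the conclusion

  module Conclusion (4≤r : 4 ≤ r) (2≤e : 2 ≤ e r) (2F<M : 2 * F r < M r)
    (X : Subset n) (minCut : IsMinCutSet (PowerAdj n) X)
    (a t : ℕ) (1≤a : 1 ≤ a) (a≤r : a ≤ r) (2≤t : 2 ≤ t) (t≤e : t ≤ e a)
    (X≐ : X ≐ λ x → ZSet a t (toℕ x)) where

    private
      1≤r = ≤-trans (s≤s z≤n) 4≤r

    minimal : ∀ c u → 1 ≤ c → c ≤ r → 1 ≤ u → u ≤ e c → size a t ≤ size c u
    minimal c u 1≤c c≤r 1≤u u≤e = subst (_≤ size c u) (card-zSet a t X X≐)
      (card-minimal (≤-trans (s≤s (s≤s z≤n)) 4≤r) X minCut c u 1≤c c≤r 1≤u u≤e)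

    open Classification 4≤r 2≤e 2F<M a t 1≤a a≤r 2≤t t≤e minimal

    conclude : t ≡ e a → (X ≐ InZ n r p a (e a)) × (∣ X ∣ ≡ β n r p a (e a))
    conclude t≡e = subst (λ s → (X ≐ InZ n r p a s) × (∣ X ∣ ≡ β n r p a s)) t≡e
      (≐-InZ a t 1≤a a≤r t≤e X X≐ , trans (card-zSet a t X X≐) (size≡β a t 1≤a a≤r 2≤t t≤e))

    Result : Set
    Result = ((3 ≤ e r ⊎ (∀ j → ¬ InΩ r p e j))
         → (X ≐ InZ n r p r (e r)) × (∣ X ∣ ≡ β n r p r (e r)))
      × (e r ≡ 2
         → (b : ℕ) → InΩ r p e b → (∀ j → InΩ r p e j → j ≤ b)
         → ((X ≐ InZ n r p r (e r)) ⊎ (X ≐ InZ n r p b (e b)))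
           × ((∣ X ∣ ≡ β n r p b (e b)) ⊎ (∣ X ∣ ≡ β n r p r (e r))))

    result-last : a ≡ r → Result
    result-last refl = let X≐Z , card = conclude (saturated 2F<M)
                       in (λ _ → X≐Z , card) , λ _ _ _ _ → inj₁ X≐Z , inj₂ card

    -- The classification puts `a` into Ω and gives `e r = 2`, so the hypothesis of the first part
    -- fails. In the second part `largest` rules out elements of Ω above `a`, whence `a = b`.
    result-inner : a < r → Result
    result-inner a<r = part-i , part-ii
      where
      a∈Ω : InΩ r p e a
      a∈Ω = 1≤a , pred-mono-≤ a<r , 3≤e a<r , small-gap a<r , ⇒2φ< a 1≤a a≤r (2F<Mₐ a<r)
      part-i : (3 ≤ e r ⊎ (∀ j → ¬ InΩ r p e j)) → (X ≐ InZ n r p r (e r)) × (∣ X ∣ ≡ β n r p r (e r))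
      part-i (inj₁ 3≤e) = contradiction (e≡2 a<r) (>⇒≢ 3≤e)
      part-i (inj₂ Ω=∅) = contradiction a∈Ω (Ω=∅ a)
      part-ii : e r ≡ 2 → (b : ℕ) → InΩ r p e b → (∀ j → InΩ r p e j → j ≤ b) →
        ((X ≐ InZ n r p r (e r)) ⊎ (X ≐ InZ n r p b (e b))) ×
        ((∣ X ∣ ≡ β n r p b (e b)) ⊎ (∣ X ∣ ≡ β n r p r (e r)))
      part-ii _ b (1≤b , b≤r-1 , 3≤e_b , gap , _) max = subst
        (λ c → ((X ≐ InZ n r p r (e r)) ⊎ (X ≐ InZ n r p c (e c))) ×
               ((∣ X ∣ ≡ β n r p c (e c)) ⊎ (∣ X ∣ ≡ β n r p r (e r))))
        (≤-antisym (max a a∈Ω) (≮⇒≥ λ a<b → largest a<r b a<b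
          (subst (suc b ≤_) (suc-pred r {{>-nonZero 1≤r}}) (s≤s b≤r-1)) 3≤e_b gap))
        (let X≐Z , card = conclude (saturated (2F<Mₐ a<r)) in inj₂ X≐Z , inj₁ card)

    result : Result
    result = case a ≟ r of λ where
      (yes a≡r) → result-last a≡r
      (no a≢r)  → result-inner (≤∧≢⇒< a≤r a≢r)

theorem1p2 : (r : ℕ) (p e : ℕ → ℕ) (n : ℕ)
    → (∀ i → 1 ≤ i → i ≤ r → Prime (p i))
    → (∀ i j → 1 ≤ i → i < j → j ≤ r → p i < p j)
    → (∀ i → 1 ≤ i → i ≤ r → 1 ≤ e i)
    → n ≡ prod (λ i → p i ^ e i) r
    → 4 ≤ r
    → 2 ≤ e r
    → 2 * φ (prod p (r ∸ 1)) < prod p (r ∸ 1)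
    → (X : Subset n)
    → IsMinCutSet (PowerAdj n) X
    → ((3 ≤ e r ⊎ (∀ j → ¬ InΩ r p e j))
         → (X ≐ InZ n r p r (e r)) × (∣ X ∣ ≡ β n r p r (e r)))
      × (e r ≡ 2
         → (b : ℕ) → InΩ r p e b → (∀ j → InΩ r p e j → j ≤ b)
         → ((X ≐ InZ n r p r (e r)) ⊎ (X ≐ InZ n r p b (e b)))
           × ((∣ X ∣ ≡ β n r p b (e b)) ⊎ (∣ X ∣ ≡ β n r p r (e r))))
theorem1p2 r p e n prime increasing e≥1 n≡ 4≤r 2≤e 2φ<P X minCut =
  let open Setting r p e n prime increasing e≥1 n≡
      M≡  = M-last (≤-trans (s≤s z≤n) 4≤r)
      -- As `r` is the last index, `M r` is the product of the first `r - 1` primes and `F r` its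
      -- totient.
      2F<M = subst₂ (λ x y → 2 * x < y) (trans (cong φ (sym M≡)) (φM≡F r)) (sym M≡) 2φ<P
      a , a≤r , 1≤a , t , t≤e , 2≤t , X≐ = min-cut-shape 4≤r 2≤e 2F<M X minCut
  in Conclusion.result 4≤r 2≤e 2F<M X minCut a t 1≤a (s≤s⁻¹ a≤r) 2≤t (s≤s⁻¹ t≤e) X≐
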